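{- For every string $T$ over an integer alphabet and every string $T'$ obtained from $T$ by one character substitution, insertion or deletion, $\mathit{g}_{is}(T')\le 4\,\mathit{g}_{is}(T)$. Hence $\mathsf{MS}_{\mathrm{x}}(\mathit{g}_{is},n)\le 4$ and $\mathsf{AS}_{\mathrm{x}}(\mathit{g}_{is},n)\le 3\,\mathit{g}_{is}$ for $\mathrm{x}\in\{\mathrm{sub},\mathrm{ins},\mathrm{del}\}$.
   Context: GCIS (grammar compression by induced sorting). Let $G$ be a string over an integer alphabet, to which a special end character $\$$ not occurring elsewhere is appended. A position $i$ of $G$ is of type L if the suffix $G[i..]$ is lexicographically larger than $G[i+1..]$, and of type S otherwise. Position $i$ is an LMS position if it is of type S and $i-1$ is of type L; by convention position $1$ and the position of $\$$ are LMS positions. If $i_1<\dots<i_{z+1}$ are the LMS positions, the GCIS-parsing of $G$ is $G=D_1\cdots D_z$ with $D_j=G[i_j..i_{j+1}-1]$. Set $G_0=T$ (alphabet $\{1,\dots,\sigma\}$). Given $G_k$ with parsing $D_1\cdots D_{z_k}$, replace each $D_i$ by the fresh integer $R_i=\sigma+1+\sum_{t<k}(\text{number of distinct factors at earlier levels})+|\{D_j: D_j\prec D_i\}|$ (so equal factors receive equal symbols, order-preserving, using the least unused symbols), and set $G_{k+1}=R_1\cdots R_{z_k}$; $G_{k+1}$ is not defined (the recursion stops) if $G_k[2..|G_k|]$ contains no LMS position. Let $r$ be the number of levels built (the height). Let $\mathcal{D}_h$ be the set of distinct factors of the GCIS-parsing of $G_{h-1}$ and $\Vert\mathcal{D}_h\Vert$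 their total length. The GCIS size is $\mathit{g}_{is}(T)=|T|$ if $r=0$, and $\mathit{g}_{is}(T)=\Vert\mathcal{D}_1\Vert+\cdots+\Vert\mathcal{D}_r\Vert+|G_r|$ otherwise. $\mathsf{MS}_{\mathrm{sub}}(C,n)=\max\{C(T')/C(T):|T|=|T'|=n,\mathsf{ed}(T,T')=1\}$ ($\mathsf{ed}$ = edit distance), with $|T'|=n+1$ (ins) or $n-1$ (del); $\mathsf{AS}$ analogously with differences. -}

module Defs where

open import Data.Bool using (Bool; true; false; if_then_else_; _∧_; not)
open import Data.Nat using (ℕ; zero; suc; _+_; _∸_; _<ᵇ_; _≤ᵇ_; _⊔_)
open import Data.List using (List; []; _∷_; _++_; length; drop; take; map; filter; upTo; foldr; deduplicate)
open import Data.List.Properties using (≡-dec)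
open import Data.Nat.Properties using (_≟_)
open import Data.Product using (_×_; _,_)
open import Data.Nat.ListAction using (sum)
open import Relation.Binary.PropositionalEquality using (_≢_)
open import Relation.Nullary.Decidable using (T?)

-- Strings are lists of natural numbers (integer alphabet).  The end marker $
-- is never stored: it is handled structurally as a character smaller than
-- every other character.

-- Strict lexicographic order on strings.  A proper prefix is smaller; this
-- coincides with comparing X$ and Y$ when $ is the unique smallest character.
lexLt : List ℕ → List ℕ → Bool
lexLt []       []       = false
lexLt []       (_ ∷ _)  = true
lexLt (_ ∷ _)  []       = false
lexLt (x ∷ xs) (y ∷ ys) = if x <ᵇ y then true else (if y <ᵇ x then false else lexLt xs ys)

-- Positions are 0-indexed here (paper position i  =  index i-1).
-- Index j of G is of type S iff the suffix G[j..]$ is lexicographically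
-- smaller than G[j+1..]$, i.e. not of type L.
isS : List ℕ → ℕ → Bool
isS G j = lexLt (drop j G) (drop (suc j) G)

-- LMS indices within 0 .. |G|-1 : index 0 by convention, or an S index
-- whose predecessor is an L index.  (The position of $ is handled separately.)
isLMS : List ℕ → ℕ → Bool
isLMS G zero    = true
isLMS G (suc j) = isS G (suc j) ∧ not (isS G j)

lmsPos : List ℕ → List ℕ
lmsPos G = filter (λ j → T? (isLMS G j)) (upTo (length G))

-- consecutive pairs (i_j , i_{j+1}) where the final LMS position is |G| (the $).
bounds : List ℕ → ℕ → List (ℕ × ℕ)
bounds []            n = []
bounds (s ∷ [])      n = (s , n) ∷ []
bounds (s ∷ t ∷ rest) n = (s , t) ∷ bounds (t ∷ rest) n

slice : List ℕ → ℕ × ℕ → List ℕ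
slice G (s , t) = take (t ∸ s) (drop s G)

factors : List ℕ → List (List ℕ)
factors G = map (slice G) (bounds (lmsPos G) (length G))

distinct : List ℕ → List (List ℕ)
distinct G = deduplicate (≡-dec _≟_) (factors G)

dictSize : List ℕ → ℕ
dictSize G = sum (map length (distinct G))

count : List (List ℕ) → (List ℕ → Bool) → ℕ
count []       p = 0
count (x ∷ xs) p = if p x then suc (count xs p) else count xs p

-- new symbol for factor D: base + |{ D' distinct : D' ≺ D }|
-- (base = σ + 1 + number of distinct factors at earlier levels)
rename : ℕ → List ℕ → List ℕ → ℕ
rename base G D = base + count (distinct G) (λ D' → lexLt D' D)

next : ℕ → List ℕ → List ℕ
next base G = map (rename base G) (factors G)

-- G_{k+1} is defined iff G_k[2..|G_k|] contains an LMS position,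
-- i.e. there are at least two LMS indices in 0 .. |G_k|-1.
continues : List ℕ → Bool
continues G = 2 ≤ᵇ length (lmsPos G)

-- fuel-bounded recursion over the levels; returns
-- ||D_{k+1}|| + ... + ||D_r|| + |G_r|  when started on G_k.
-- Each built level strictly shortens the string, so fuel |T| is never exhausted.
gisGo : ℕ → ℕ → List ℕ → ℕ
gisGo zero    base G = length G
gisGo (suc f) base G =
  if continues G
  then dictSize G + gisGo f (base + length (distinct G)) (next base G)
  else length G

-- σ : the alphabet of T is {1, ..., σ}, σ = largest character of T.
sigma : List ℕ → ℕ
sigma T = foldr _⊔_ 0 T

gis : List ℕ → ℕ
gis T = gisGo (length T) (suc (sigma T)) T

data OneEdit : List ℕ → List ℕ → Set where
  sub : (xs ys : List ℕ) (a b : ℕ) → a ≢ b → OneEdit (xs ++ a ∷ ys) (xs ++ b ∷ ys)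
  ins : (xs ys : List ℕ) (b : ℕ) → OneEdit (xs ++ ys) (xs ++ b ∷ ys)
  del : (xs ys : List ℕ) (a : ℕ) → OneEdit (xs ++ a ∷ ys) (xs ++ ys)

{-# OPTIONS --safe #-}
module Submission where

-- Reading a string from right to left, its parsing is an open chunk followed by
-- closed factors, and prepending a character depends only on the current head,
-- its type and whether it cuts.  Let G′ arise from G by replacing a window, the
-- new one having w ≤ 4 symbols.  Left of the window the two parsings can differ
-- only through the run adjacent to it and up to the next common cut, so G′ has
-- at most 4 factors that are not known to occur in G; their total length is
-- below w + 3M for M the length of some factor of G (one M for the part left of
-- the run, one for the run, one for the part right of the window, and one symbol
-- to spare, because an S-run is properly contained in its factor).  Ranking the
-- factors of both strings jointly turns the next levels into strings that again
-- differ in a window of at most 4 symbols, and sizes are invariant under such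
-- order-preserving renamings.
--
-- Hence ||D′|| < ||D|| + w + 3M on every level, which is at most 4||D|| with
-- enough slack when ||D|| ≥ M + 2.  Otherwise all factors but the first are
-- equal, the recursion on G stops at the next level, and the rest of the size of
-- G′ is bounded through the length alone, as |G_{k+1}| ≤ (|G_k| + 1)/2.  For
-- w = 4 this gives gis G′ ≤ 4 gis G + 6, and the slack of the first level, where
-- w = 1, absorbs the 6.

open import Defs
open import Data.Nat using (ℕ; _≤_; _*_; _∸_)
open import Data.List using (List; [])
open import Data.Product using (_×_)
open import Relation.Binary.PropositionalEquality using (_≢_)

open import Data.Bool using (Bool; true; false; if_then_else_; _∧_; not; T)
open import Data.Bool.Properties using (∧-zeroʳ; ∧-inverseʳ; T-≡)
open import Data.Empty using (⊥-elim)
open import Data.List using (_∷_; _++_; length; map; filter; applyUpTo; deduplicate)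
open import Data.List.Membership.Propositional using (_∈_; find)
open import Data.List.Membership.Propositional.Properties using (∈-∃++; ∈-++⁺ˡ; ∈-++⁺ʳ; ∈-++⁻; ∈-deduplicate⁺; ∈-deduplicate⁻)
open import Data.List.Properties using (map-∘; map-++; length-map; length-++; ≡-dec)
open import Data.List.Relation.Binary.Pointwise as PW using (Pointwise; []; _∷_; Pointwise-length)
open import Data.List.Relation.Unary.All as All using (All; []; _∷_)
open import Data.List.Relation.Unary.All.Properties using (¬All⇒Any¬; map⁺)
open import Data.List.Relation.Unary.AllPairs using ([]; _∷_)
open import Data.List.Relation.Unary.Any using (Any; here; there)
open import Data.List.Relation.Unary.Unique.DecPropositional.Properties using (deduplicate-!)
open import Data.List.Relation.Unary.Unique.Propositional using (Unique)
open import Data.Nat using (zero; suc; z≤n; s≤s; _+_; _⊔_; _<_; _<ᵇ_; _≤ᵇ_; _≤?_; ⌈_/2⌉)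
open import Data.Nat.Induction using (<-rec)
open import Data.Nat.ListAction using (sum)
open import Data.Nat.ListAction.Properties using (sum-++)
open import Data.Nat.Properties
open import Data.Nat.Tactic.RingSolver using (solve-∀)
open import Data.Product using (_,_; proj₁; proj₂; ∃-syntax)
open import Data.Sum using (_⊎_; inj₁; inj₂)
open import Function using (_∘_; id; flip)
open import Function.Bundles using (Equivalence)
open import Relation.Binary using (tri<; tri≈; tri>)
open import Relation.Binary.PropositionalEquality using (_≡_; refl; sym; trans; cong; cong₂; subst; subst₂; ≢-sym)
open import Relation.Nullary using (yes; no)
open import Relation.Nullary.Decidable using (T?)

-- Right-to-left parsing of a string

Str : Set
Str = List ℕ

-- true for type S; the empty string counts as L.
typ : Str → Bool
typ G = isS G 0

-- Prepending `c` makes the first position of `G` an LMS position, so the open chunk of `G` becomes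
-- a factor.
closes : ℕ → Str → Bool
closes c G = typ G ∧ not (typ (c ∷ G))

-- The first factor; its left end may still move when G is extended to the left.
chunk : Str → Str
chunk []      = []
chunk (c ∷ G) = if closes c G then c ∷ [] else c ∷ chunk G

closed : Str → List Str
closed []      = []
closed (c ∷ G) = if closes c G then chunk G ∷ closed G else closed G

filter-shift : ∀ (p q : ℕ → Bool) (f : ℕ → ℕ) → (∀ i → p (suc (f i)) ≡ q (f i)) → ∀ n →
  filter (T? ∘ p) (applyUpTo (suc ∘ f) n) ≡ map suc (filter (T? ∘ q) (applyUpTo f n))
filter-shift p q f eq zero    = refl
filter-shift p q f eq (suc n) with p (suc (f 0)) | q (f 0) | eq 0
... | true  | true  | _ = cong (suc (f 0) ∷_) (filter-shift p q (f ∘ suc) (eq ∘ suc) n)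
... | false | false | _ = filter-shift p q (f ∘ suc) (eq ∘ suc) n

-- Index 0 is left out: it is LMS by convention and need not remain so when a character is
-- prepended.
inner : Str → List ℕ
inner G = filter (T? ∘ isLMS G) (applyUpTo suc (length G ∸ 1))

inner-∷ : ∀ c b G → inner (c ∷ b ∷ G) ≡
  (if closes c (b ∷ G) then 1 ∷ map suc (inner (b ∷ G)) else map suc (inner (b ∷ G)))
inner-∷ c b G with closes c (b ∷ G)
... | true  = cong (1 ∷_) (filter-shift (isLMS (c ∷ b ∷ G)) (isLMS (b ∷ G)) suc (λ _ → refl) (length G))
... | false = filter-shift (isLMS (c ∷ b ∷ G)) (isLMS (b ∷ G)) suc (λ _ → refl) (length G)

suc² : ℕ × ℕ → ℕ × ℕ
suc² (s , t) = suc s , suc t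

bounds-suc : ∀ ps n → bounds (map suc ps) (suc n) ≡ map suc² (bounds ps n)
bounds-suc []           n = refl
bounds-suc (s ∷ [])     n = refl
bounds-suc (s ∷ t ∷ ps) n = cong (_ ∷_) (bounds-suc (t ∷ ps) n)

slices-suc : ∀ c G bs → map (slice (c ∷ G)) (map suc² bs) ≡ map (slice G) bs
slices-suc c G bs = sym (map-∘ bs)

-- Prepending `c` shifts the inner LMS indices by one and makes index 1 LMS exactly when `c` closes.
-- So either all old slices survive behind the new factor `c ∷ []`, or only the first slice grows.
factors-parse : ∀ c G → factors (c ∷ G) ≡ chunk (c ∷ G) ∷ closed (c ∷ G)
factors-parse c []      = refl
factors-parse c (b ∷ G) = trans (cong (λ I → map (slice (c ∷ b ∷ G)) (bounds (0 ∷ I) (suc (suc (length G))))) (inner-∷ c b G)) step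
  where
  n = suc (length G)
  I = inner (b ∷ G)
  all-shifted : map (slice (c ∷ b ∷ G)) (bounds (1 ∷ map suc I) (suc n)) ≡ chunk (b ∷ G) ∷ closed (b ∷ G)
  all-shifted = trans (cong (map _) (bounds-suc (0 ∷ I) n))
                  (trans (slices-suc c (b ∷ G) (bounds (0 ∷ I) n)) (factors-parse b G))
  extend : ∀ J D Ds → map (slice (b ∷ G)) (bounds (0 ∷ J) n) ≡ D ∷ Ds →
    map (slice (c ∷ b ∷ G)) (bounds (0 ∷ map suc J) (suc n)) ≡ (c ∷ D) ∷ Ds
  extend []      D Ds refl = refl
  extend (t ∷ J) D Ds refl = cong (_ ∷_)
    (trans (cong (map _) (bounds-suc (t ∷ J) n)) (slices-suc c (b ∷ G) (bounds (t ∷ J) n)))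
  step : map (slice (c ∷ b ∷ G)) (bounds (0 ∷ (if closes c (b ∷ G) then 1 ∷ map suc I else map suc I)) (suc n))
           ≡ chunk (c ∷ b ∷ G) ∷ closed (c ∷ b ∷ G)
  step with closes c (b ∷ G)
  ... | true  = cong ((c ∷ []) ∷_) all-shifted
  ... | false = extend I _ _ (factors-parse b G)

size : List Str → ℕ
size = sum ∘ map length

chunk-nonempty : ∀ c G → 1 ≤ length (chunk (c ∷ G))
chunk-nonempty c G with closes c G
... | true  = s≤s z≤n
... | false = s≤s z≤n

size-parse : ∀ G → length (chunk G) + size (closed G) ≡ length G
size-parse []      = refl
size-parse (c ∷ G) with closes c G
... | true  = cong suc (size-parse G)
... | false = cong suc (size-parse G)

closes-S : ∀ c G → typ (c ∷ G) ≡ true → closes c G ≡ false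
closes-S c G eq = trans (cong (λ t → typ G ∧ not t) eq) (∧-zeroʳ (typ G))

closes-above-L : ∀ c G → typ G ≡ false → closes c G ≡ false
closes-above-L c G eq = cong (_∧ not (typ (c ∷ G))) eq

closes⇒S : ∀ c G → closes c G ≡ true → typ G ≡ true
closes⇒S c G eq with typ G | eq
... | true | _ = refl

closes⇒L : ∀ c G → closes c G ≡ true → typ (c ∷ G) ≡ false
closes⇒L c G eq with typ G | typ (c ∷ G) | eq
... | true | false | _ = refl

chunk-open : ∀ c G → closes c G ≡ false → chunk (c ∷ G) ≡ c ∷ chunk G
chunk-open c G eq = cong (if_then c ∷ [] else c ∷ chunk G) eq

closed-open : ∀ c G → closes c G ≡ false → closed (c ∷ G) ≡ closed G
closed-open c G eq = cong (if_then chunk G ∷ closed G else closed G) eq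

chunk-close : ∀ c G → closes c G ≡ true → chunk (c ∷ G) ≡ c ∷ []
chunk-close c G eq = cong (if_then c ∷ [] else c ∷ chunk G) eq

closed-close : ∀ c G → closes c G ≡ true → closed (c ∷ G) ≡ chunk G ∷ closed G
closed-close c G eq = cong (if_then chunk G ∷ closed G else closed G) eq

-- A character of type S does not close, and it is never the last one because the end marker is
-- smaller than every character.
typ⇒2≤chunk : ∀ G → typ G ≡ true → 2 ≤ length (chunk G)
typ⇒2≤chunk []          ()
typ⇒2≤chunk (c ∷ [])    ()
typ⇒2≤chunk (c ∷ b ∷ G) eq rewrite chunk-open c (b ∷ G) (closes-S c (b ∷ G) eq) =
  s≤s (chunk-nonempty b G)

closed-long : ∀ G → All (λ D → 2 ≤ length D) (closed G)
closed-long []      = []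
closed-long (c ∷ G) with closes c G in eq
... | true  = typ⇒2≤chunk G (closes⇒S c G eq) ∷ closed-long G
... | false = closed-long G

size-long : ∀ Ds → All (λ D → 2 ≤ length D) Ds → length Ds * 2 ≤ size Ds
size-long []       []       = z≤n
size-long (D ∷ Ds) (p ∷ ps) = +-mono-≤ p (size-long Ds ps)

-- Every factor but the first begins with type S and so has length at least 2; the first may have
-- length 1.
length-factors : ∀ G → length (factors G) * 2 ≤ suc (length G)
length-factors []      = z≤n
length-factors (c ∷ G) rewrite factors-parse c G = begin
  2 + length (closed (c ∷ G)) * 2                  ≤⟨ +-monoʳ-≤ 2 (size-long _ (closed-long (c ∷ G))) ⟩
  2 + size (closed (c ∷ G))                        ≤⟨ s≤s (+-monoˡ-≤ _ (chunk-nonempty c G)) ⟩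
  suc (length (chunk (c ∷ G)) + size (closed (c ∷ G))) ≡⟨ cong suc (size-parse (c ∷ G)) ⟩
  suc (length (c ∷ G))                             ∎
  where open ≤-Reasoning

size-factors : ∀ G → size (factors G) ≡ length G
size-factors []      = refl
size-factors (c ∷ G) = trans (cong size (factors-parse c G)) (size-parse (c ∷ G))

length-bounds : ∀ ps n → length (bounds ps n) ≡ length ps
length-bounds []           n = refl
length-bounds (s ∷ [])     n = refl
length-bounds (s ∷ t ∷ ps) n = cong suc (length-bounds (t ∷ ps) n)

continues-factors : ∀ G → continues G ≡ (2 ≤ᵇ length (factors G))
continues-factors G = cong (2 ≤ᵇ_)
  (sym (trans (length-map (slice G) (bounds (lmsPos G) (length G))) (length-bounds (lmsPos G) (length G))))

-- Parsings of two strings that differ in a window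

parts : Str → List Str
parts G = chunk G ∷ closed G

Long : ℕ → Str → Set
Long m G = Any (λ D → m ≤ length D) (parts G)

Long-chunk : ∀ G → Long (length (chunk G)) G
Long-chunk G = here ≤-refl

Long-∷ : ∀ {m} c G → Long m G → Long m (c ∷ G)
Long-∷ c G l with closes c G
Long-∷ c G l         | true  = there l
Long-∷ c G (here p)  | false = here (m≤n⇒m≤1+n p)
Long-∷ c G (there p) | false = there p

Long-++ : ∀ {m} xs G → Long m G → Long m (xs ++ G)
Long-++ []       G l = l
Long-++ (x ∷ xs) G l = Long-∷ x (xs ++ G) (Long-++ xs G l)

Long-⊔ : ∀ {m n} G → Long m G → Long n G → Long (m ⊔ n) G
Long-⊔ {m} {n} G p q with ⊔-sel m n
... | inj₁ eq = subst (λ k → Long k G) (sym eq) p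
... | inj₂ eq = subst (λ k → Long k G) (sym eq) q

Long-1 : ∀ c G → Long 1 (c ∷ G)
Long-1 c G = here (chunk-nonempty c G)

φ : Str → ℕ
φ G = if typ G then 1 else 0

φ≤1 : ∀ G → φ G ≤ 1
φ≤1 G with typ G
... | true  = s≤s z≤n
... | false = z≤n

-- A cut needs an L-character in front of an S-character, so two successive
-- prepended characters cannot both cut: φ pays for the next cut in advance.
cuts-∷ : ∀ d H y P → closed H ≡ P ++ closed y → ∃[ Q ]
  closed (d ∷ H) ≡ Q ++ closed y
  × length Q * 2 + φ (d ∷ H) ≤ suc (length P * 2 + φ H)
  × size Q + length (chunk (d ∷ H)) ≡ suc (size P + length (chunk H))
cuts-∷ d H y P eq with closes d H in cl
... | true  = chunk H ∷ P , cong (chunk H ∷_) eq , budget , sizes (length (chunk H)) (size P)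
  where
  budget : suc (length P) * 2 + φ (d ∷ H) ≤ suc (length P * 2 + φ H)
  budget rewrite closes⇒S d H cl | closes⇒L d H cl =
    ≤-reflexive (arith (length P * 2))
    where arith : ∀ p → 2 + p + 0 ≡ suc (p + 1)
          arith = solve-∀
  sizes : ∀ c p → c + p + 1 ≡ suc (p + c)
  sizes = solve-∀
... | false = P , eq , ≤-trans (+-monoʳ-≤ (length P * 2) (φ≤1 (d ∷ H))) lem , +-suc (size P) _
  where
  lem : length P * 2 + 1 ≤ suc (length P * 2 + φ H)
  lem = ≤-trans (≤-reflexive (+-comm (length P * 2) 1)) (s≤s (m≤m+n _ _))

cuts-++ : ∀ u y → ∃[ P ]
  closed (u ++ y) ≡ P ++ closed y
  × length P * 2 + φ (u ++ y) ≤ length u + φ y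
  × size P + length (chunk (u ++ y)) ≡ length u + length (chunk y)
cuts-++ []      y = [] , refl , ≤-refl , refl
cuts-++ (d ∷ u) y with cuts-++ u y
... | P , eq , n , s with cuts-∷ d (u ++ y) y P eq
... | Q , eq′ , n′ , s′ = Q , eq′ , ≤-trans n′ (s≤s n) , trans s′ (cong suc s)

<ᵇ-true : ∀ {m n} → m < n → (m <ᵇ n) ≡ true
<ᵇ-true p = Equivalence.to T-≡ (<⇒<ᵇ p)

<ᵇ-false : ∀ {m n} → n ≤ m → (m <ᵇ n) ≡ false
<ᵇ-false {m} {n} p with m <ᵇ n in eq
... | false = refl
... | true  = ⊥-elim (<⇒≱ (<ᵇ⇒< m n (subst T (sym eq) _)) p)

typ-less : ∀ {d c} t → d < c → typ (d ∷ c ∷ t) ≡ true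
typ-less t p rewrite <ᵇ-true p = refl

typ-greater : ∀ {d c} t → c < d → typ (d ∷ c ∷ t) ≡ false
typ-greater t p rewrite <ᵇ-false (<⇒≤ p) | <ᵇ-true p = refl

typ-same : ∀ c t → typ (c ∷ c ∷ t) ≡ typ (c ∷ t)
typ-same c t rewrite <ᵇ-false (≤-refl {c}) = refl

-- Equal neighbours have the same type, so no cut falls inside a run.
closes-same : ∀ c t → closes c (c ∷ t) ≡ false
closes-same c t = trans (cong (λ b → typ (c ∷ t) ∧ not b) (typ-same c t)) (∧-inverseʳ (typ (c ∷ t)))

typ-∷ : ∀ d c t t′ → typ (c ∷ t) ≡ typ (c ∷ t′) → typ (d ∷ c ∷ t) ≡ typ (d ∷ c ∷ t′)
typ-∷ d c t t′ eq = cong (λ b → if d <ᵇ c then true else (if c <ᵇ d then false else b)) eq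

closes-∷ : ∀ d c t t′ → typ (c ∷ t) ≡ typ (c ∷ t′) → closes d (c ∷ t) ≡ closes d (c ∷ t′)
closes-∷ d c t t′ eq = cong₂ (λ a b → a ∧ not b) eq (typ-∷ d c t t′ eq)

-- Comparison of two strings with common suffix y while a common prefix is being
-- prepended to them: still inside the run next to the window, past the run but
-- before the first common cut, and past that cut.
data Phase (w : ℕ) (y : Str) : Str → Str → Set where
  run : ∀ {c t t′} P P′ m →
    closed (c ∷ t) ≡ P ++ closed y → closed (c ∷ t′) ≡ P′ ++ closed y →
    -- The budget is one for the first character left of the window, four for the window and one for
    -- the type of `y`.
    length P′ * 2 + φ (c ∷ t′) ≤ 6 →
    size P′ + length (chunk (c ∷ t′)) ≤ w + m + length (chunk (c ∷ t)) →
    -- In a run of type S the open chunk of the first string has at least two characters, which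
    -- makes the bound strict. Only such a run can end with a cut in that string.
    (typ (c ∷ t) ≡ true → size P′ + length (chunk (c ∷ t′)) < w + m + length (chunk (c ∷ t))) →
    Long m (c ∷ t) → Phase w y (c ∷ t) (c ∷ t′)
  apart : ∀ {c t t′} P P′ m → typ (c ∷ t) ≡ typ (c ∷ t′) →
    closed (c ∷ t) ≡ P ++ closed y → closed (c ∷ t′) ≡ P′ ++ closed y →
    length P′ ≤ 3 →
    size P′ + length (chunk (c ∷ t′)) < w + (m + m) + length (chunk (c ∷ t)) →
    Long m (c ∷ t) → Phase w y (c ∷ t) (c ∷ t′)
  synced : ∀ {c t t′} A B B′ C m → typ (c ∷ t) ≡ typ (c ∷ t′) → chunk (c ∷ t) ≡ chunk (c ∷ t′) →
    closed (c ∷ t) ≡ A ++ B ++ C → closed (c ∷ t′) ≡ A ++ B′ ++ C →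
    length B′ ≤ 4 → size B′ < w + (m + (m + m)) →
    Long m (c ∷ t) → Phase w y (c ∷ t) (c ∷ t′)

+-suc-<′ : ∀ a b c d → a + b < c + d → ∀ {b′ d′} → b′ ≡ suc b → d′ ≡ suc d → a + b′ < c + d′
+-suc-<′ a b c d p refl refl = subst₂ _<_ (sym (+-suc a b)) (sym (+-suc c d)) (s≤s p)

halve : ∀ p f → p * 2 + f ≤ 7 → p ≤ 3
halve p f le with p ≤? 3
... | yes q = q
... | no q = ⊥-elim (<⇒≱ (≤-trans (*-monoˡ-≤ 2 (≰⇒> q)) (m≤m+n (p * 2) f)) le)

-- The run ends at `d`, and the strings may disagree on whether `d` cuts, as the run may have
-- different types in them. If it cuts in the first string, the chunk closed there, of length `k`,
-- supplies the second summand of `m + m`; if not, that summand only has to provide one unit.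
leave : ∀ {w y c t t′} d P P′ m → typ (d ∷ c ∷ t) ≡ typ (d ∷ c ∷ t′) →
  closed (c ∷ t) ≡ P ++ closed y → closed (c ∷ t′) ≡ P′ ++ closed y →
  length P′ * 2 + φ (c ∷ t′) ≤ 6 →
  size P′ + length (chunk (c ∷ t′)) ≤ w + m + length (chunk (c ∷ t)) →
  (typ (c ∷ t) ≡ true → size P′ + length (chunk (c ∷ t′)) < w + m + length (chunk (c ∷ t))) →
  Long m (c ∷ t) → Phase w y (d ∷ c ∷ t) (d ∷ c ∷ t′)
leave {w} {y} {c} {t} {t′} d P P′ m tq eq eq′ n s s< l
  with cuts-∷ d (c ∷ t′) y P′ eq′ | closes d (c ∷ t) in cl
... | Q′ , eqQ′ , nQ′ , sQ′ | true =
  apart (chunk (c ∷ t) ∷ P) Q′ (m ⊔ k) tq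
    (trans (closed-close d (c ∷ t) cl) (cong (chunk (c ∷ t) ∷_) eq)) eqQ′
    (halve (length Q′) _ (≤-trans nQ′ (s≤s n))) bound
    (Long-∷ d (c ∷ t) (Long-⊔ (c ∷ t) l (Long-chunk (c ∷ t))))
  where
  k = length (chunk (c ∷ t))
  open ≤-Reasoning
  bound : size Q′ + length (chunk (d ∷ c ∷ t′)) < w + ((m ⊔ k) + (m ⊔ k)) + length (chunk (d ∷ c ∷ t))
  bound = begin-strict
    size Q′ + length (chunk (d ∷ c ∷ t′))      ≡⟨ sQ′ ⟩
    suc (size P′ + length (chunk (c ∷ t′)))    <⟨ s≤s (s< (closes⇒S d (c ∷ t) cl)) ⟩
    suc (w + m + k)                            ≡⟨ cong suc (+-assoc w m k) ⟩
    suc (w + (m + k))                          ≤⟨ s≤s (+-monoʳ-≤ w (+-mono-≤ (m≤m⊔n m k) (m≤n⊔m m k))) ⟩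
    suc (w + ((m ⊔ k) + (m ⊔ k)))                  ≡⟨ +-comm 1 _ ⟩
    w + ((m ⊔ k) + (m ⊔ k)) + 1                    ≡⟨ cong (λ D → w + ((m ⊔ k) + (m ⊔ k)) + length D) (sym (chunk-close d (c ∷ t) cl)) ⟩
    w + ((m ⊔ k) + (m ⊔ k)) + length (chunk (d ∷ c ∷ t)) ∎
... | Q′ , eqQ′ , nQ′ , sQ′ | false =
  apart P Q′ (m ⊔ 1) tq (trans (closed-open d (c ∷ t) cl) eq) eqQ′
    (halve (length Q′) _ (≤-trans nQ′ (s≤s n))) bound
    (Long-∷ d (c ∷ t) (Long-⊔ (c ∷ t) l (Long-1 c t)))
  where
  k = length (chunk (c ∷ t))
  arith : ∀ w m k → suc (w + m + k) ≡ w + (m + 1) + k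
  arith = solve-∀
  open ≤-Reasoning
  bound : size Q′ + length (chunk (d ∷ c ∷ t′)) < w + ((m ⊔ 1) + (m ⊔ 1)) + length (chunk (d ∷ c ∷ t))
  bound = begin-strict
    size Q′ + length (chunk (d ∷ c ∷ t′))      ≡⟨ sQ′ ⟩
    suc (size P′ + length (chunk (c ∷ t′)))    ≤⟨ s≤s s ⟩
    suc (w + m + k)                            ≡⟨ arith w m k ⟩
    w + (m + 1) + k                            ≤⟨ +-monoˡ-≤ k (+-monoʳ-≤ w (+-mono-≤ (m≤m⊔n m 1) (m≤n⊔m m 1))) ⟩
    w + ((m ⊔ 1) + (m ⊔ 1)) + k                    <⟨ +-monoʳ-< (w + ((m ⊔ 1) + (m ⊔ 1))) (n<1+n k) ⟩
    w + ((m ⊔ 1) + (m ⊔ 1)) + suc k                ≡⟨ cong (λ D → w + ((m ⊔ 1) + (m ⊔ 1)) + length D) (sym (chunk-open d (c ∷ t) cl)) ⟩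
    w + ((m ⊔ 1) + (m ⊔ 1)) + length (chunk (d ∷ c ∷ t)) ∎

-- Equal heads of equal type make every cut common. Inside the run nothing cuts, and a character
-- different from the run gets the same type in both strings by comparison with its neighbour.
push : ∀ {w y H H′} d → Phase w y H H′ → Phase w y (d ∷ H) (d ∷ H′)
push {w} {y} d (synced {c} {t} {t′} A B B′ C m tq cq eq eq′ n s l)
  with closes d (c ∷ t) in cl
... | true  = synced (chunk (c ∷ t) ∷ A) B B′ C m (typ-∷ d c t t′ tq)
      (trans (chunk-close d (c ∷ t) cl) (sym (chunk-close d (c ∷ t′) cl′)))
      (trans (closed-close d (c ∷ t) cl) (cong (chunk (c ∷ t) ∷_) eq))
      (trans (closed-close d (c ∷ t′) cl′) (cong₂ _∷_ (sym cq) eq′)) n s (Long-∷ d (c ∷ t) l)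
  where cl′ = trans (sym (closes-∷ d c t t′ tq)) cl
... | false = synced A B B′ C m (typ-∷ d c t t′ tq)
      (trans (chunk-open d (c ∷ t) cl) (trans (cong (d ∷_) cq) (sym (chunk-open d (c ∷ t′) cl′))))
      (trans (closed-open d (c ∷ t) cl) eq)
      (trans (closed-open d (c ∷ t′) cl′) eq′) n s (Long-∷ d (c ∷ t) l)
  where cl′ = trans (sym (closes-∷ d c t t′ tq)) cl
push {w} {y} d (apart {c} {t} {t′} P P′ m tq eq eq′ n s l)
  with closes d (c ∷ t) in cl
-- At the first common cut the chunk closed in the first string, of length `k`, supplies the third
-- summand.
... | true  = synced [] (chunk (c ∷ t) ∷ P) (chunk (c ∷ t′) ∷ P′) (closed y) (m ⊔ k) (typ-∷ d c t t′ tq)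
      (trans (chunk-close d (c ∷ t) cl) (sym (chunk-close d (c ∷ t′) cl′)))
      (trans (closed-close d (c ∷ t) cl) (cong (chunk (c ∷ t) ∷_) eq))
      (trans (closed-close d (c ∷ t′) cl′) (cong (chunk (c ∷ t′) ∷_) eq′))
      (s≤s n) bound (Long-∷ d (c ∷ t) (Long-⊔ (c ∷ t) l (Long-chunk (c ∷ t))))
  where
  cl′ = trans (sym (closes-∷ d c t t′ tq)) cl
  k   = length (chunk (c ∷ t))
  arith : ∀ w m k → w + (m + m) + k ≡ w + (m + (m + k))
  arith = solve-∀
  bound : length (chunk (c ∷ t′)) + size P′ < w + ((m ⊔ k) + ((m ⊔ k) + (m ⊔ k)))
  bound = begin-strict
    length (chunk (c ∷ t′)) + size P′ ≡⟨ +-comm (length (chunk (c ∷ t′))) (size P′) ⟩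
    size P′ + length (chunk (c ∷ t′)) <⟨ s ⟩
    w + (m + m) + k                   ≡⟨ arith w m k ⟩
    w + (m + (m + k))                 ≤⟨ +-monoʳ-≤ w (+-mono-≤ (m≤m⊔n m k) (+-mono-≤ (m≤m⊔n m k) (m≤n⊔m m k))) ⟩
    w + ((m ⊔ k) + ((m ⊔ k) + (m ⊔ k)))     ∎
    where open ≤-Reasoning
... | false = apart P P′ m (typ-∷ d c t t′ tq)
      (trans (closed-open d (c ∷ t) cl) eq) (trans (closed-open d (c ∷ t′) cl′) eq′) n
      (+-suc-<′ (size P′) _ (w + (m + m)) _ s (cong length (chunk-open d (c ∷ t′) cl′)) (cong length (chunk-open d (c ∷ t) cl)))
      (Long-∷ d (c ∷ t) l)
  where cl′ = trans (sym (closes-∷ d c t t′ tq)) cl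
push {w} {y} d (run {c} {t} {t′} P P′ m eq eq′ n s s< l) with <-cmp d c
... | tri≈ _ refl _ = run P P′ m
      (trans (closed-open d (c ∷ t) (closes-same c t)) eq)
      (trans (closed-open d (c ∷ t′) (closes-same c t′)) eq′)
      (subst (λ b → length P′ * 2 + (if b then 1 else 0) ≤ 6) (sym (typ-same c t′)) n)
      (≤-pred (+-suc-<′ (size P′) _ (suc w + m) _ (s≤s s) q′ q))
      (λ tc → +-suc-<′ (size P′) _ (w + m) _ (s< (trans (sym (typ-same c t)) tc)) q′ q)
      (Long-∷ d (c ∷ t) l)
  where
  q  = cong length (chunk-open d (c ∷ t) (closes-same c t))
  q′ = cong length (chunk-open d (c ∷ t′) (closes-same c t′))
... | tri< p _ _ = leave d P P′ m (trans (typ-less t p) (sym (typ-less t′ p))) eq eq′ n s s< l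
... | tri> _ _ p = leave d P P′ m (trans (typ-greater t p) (sym (typ-greater t′ p))) eq eq′ n s s< l

module _ (u u′ y : Str) (u′≤4 : length u′ ≤ 4) where

  private w = length u′

  phase : ∀ x xs → Phase w y (x ∷ xs ++ u ++ y) (x ∷ xs ++ u′ ++ y)
  phase x (x₁ ∷ xs) = push x (phase x₁ xs)
  -- `x` is taken together with the window, since a phase needs a head shared by both strings. The
  -- open chunk of the first string contains `x` and pays for it.
  phase x []        with cuts-++ (x ∷ u) y | cuts-++ (x ∷ u′) y
  ... | P , eq , _ | P′ , eq′ , n , s =
    run P P′ m eq eq′ (≤-trans n (s≤s (+-mono-≤ u′≤4 (φ≤1 y))))
      (≤-pred (bound 1 (chunk-nonempty x (u ++ y))))
      (λ t → ≤-pred (bound 2 (typ⇒2≤chunk (x ∷ u ++ y) t)))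
      (Long-++ (x ∷ u) y (Long-chunk y))
    where
    m = length (chunk y)
    open ≤-Reasoning
    bound : ∀ j → j ≤ length (chunk (x ∷ u ++ y)) →
      j + (size P′ + length (chunk (x ∷ u′ ++ y))) ≤ suc (w + m + length (chunk (x ∷ u ++ y)))
    bound j p = begin
      j + (size P′ + length (chunk (x ∷ u′ ++ y))) ≡⟨ cong (j +_) s ⟩
      j + suc (w + m)                              ≡⟨ +-comm j _ ⟩
      suc (w + m + j)                              ≤⟨ s≤s (+-monoʳ-≤ (w + m) p) ⟩
      suc (w + m + length (chunk (x ∷ u ++ y)))    ∎

record Window (w : ℕ) (G G′ : Str) : Set where
  constructor window
  field
    prefix old new suffix : List Str
    m         : ℕ
    before    : parts G ≡ prefix ++ old ++ suffix
    after     : parts G′ ≡ prefix ++ new ++ suffix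
    few       : length new ≤ 4
    small     : size new < w + (m + (m + m))
    long      : Long m G

-- At the left end the open chunk becomes the first factor. If no common cut has occurred, it
-- belongs to the differing part, and its length `k` supplies a missing summand of `m + (m + m)`.
phase⇒window : ∀ {w y H H′} → Phase w y H H′ → Window w H H′
phase⇒window (synced {c} {t} {t′} A B B′ C m tq cq eq eq′ n s l) =
  window (chunk (c ∷ t) ∷ A) B B′ C m (cong (chunk (c ∷ t) ∷_) eq) (cong₂ _∷_ (sym cq) eq′) n s l
phase⇒window {w} {y} (apart {c} {t} {t′} P P′ m tq eq eq′ n s l) =
  window [] (chunk (c ∷ t) ∷ P) (chunk (c ∷ t′) ∷ P′) (closed y) (m ⊔ k) (cong (chunk (c ∷ t) ∷_) eq) (cong (chunk (c ∷ t′) ∷_) eq′) (s≤s n)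
    bound (Long-⊔ (c ∷ t) l (Long-chunk (c ∷ t)))
  where
  k = length (chunk (c ∷ t))
  arith : ∀ w m k → w + (m + m) + k ≡ w + (m + (m + k))
  arith = solve-∀
  open ≤-Reasoning
  bound : length (chunk (c ∷ t′)) + size P′ < w + ((m ⊔ k) + ((m ⊔ k) + (m ⊔ k)))
  bound = begin-strict
    length (chunk (c ∷ t′)) + size P′ ≡⟨ +-comm (length (chunk (c ∷ t′))) (size P′) ⟩
    size P′ + length (chunk (c ∷ t′)) <⟨ s ⟩
    w + (m + m) + k                   ≡⟨ arith w m k ⟩
    w + (m + (m + k))                 ≤⟨ +-monoʳ-≤ w (+-mono-≤ (m≤m⊔n m k) (+-mono-≤ (m≤m⊔n m k) (m≤n⊔m m k))) ⟩
    w + ((m ⊔ k) + ((m ⊔ k) + (m ⊔ k)))     ∎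
phase⇒window {w} {y} (run {c} {t} {t′} P P′ m eq eq′ n s s< l) =
  window [] (chunk (c ∷ t) ∷ P) (chunk (c ∷ t′) ∷ P′) (closed y) (m ⊔ k) (cong (chunk (c ∷ t) ∷_) eq) (cong (chunk (c ∷ t′) ∷_) eq′)
    (s≤s (halve (length P′) _ (m≤n⇒m≤1+n n)))
    bound (Long-⊔ (c ∷ t) l (Long-chunk (c ∷ t)))
  where
  k = length (chunk (c ∷ t))
  arith : ∀ w m k → suc (w + m + k) ≡ w + (m + (k + 1))
  arith = solve-∀
  open ≤-Reasoning
  bound : length (chunk (c ∷ t′)) + size P′ < w + ((m ⊔ k) + ((m ⊔ k) + (m ⊔ k)))
  bound = begin
    suc (length (chunk (c ∷ t′)) + size P′) ≡⟨ cong suc (+-comm (length (chunk (c ∷ t′))) (size P′)) ⟩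
    suc (size P′ + length (chunk (c ∷ t′))) ≤⟨ s≤s s ⟩
    suc (w + m + k)                         ≡⟨ arith w m k ⟩
    w + (m + (k + 1))                       ≤⟨ +-monoʳ-≤ w (+-mono-≤ (m≤m⊔n m k) (+-mono-≤ (m≤n⊔m m k) (≤-trans (chunk-nonempty c t) (m≤n⊔m m k)))) ⟩
    w + ((m ⊔ k) + ((m ⊔ k) + (m ⊔ k)))           ∎

-- Without a character left of the window there is no run to follow. The maximum with 1 keeps the
-- bound strict when `y` is empty.
window-start : ∀ u u′ y → length u′ ≤ 4 → 1 ≤ length (u ++ y) → Window (length u′) (u ++ y) (u′ ++ y)
window-start u u′ y u′≤4 pos with cuts-++ u y | cuts-++ u′ y
... | P , eq , _ | P′ , eq′ , n , s =
  window [] (chunk (u ++ y) ∷ P) (chunk (u′ ++ y) ∷ P′) (closed y) (m ⊔ 1) (cong (chunk (u ++ y) ∷_) eq) (cong (chunk (u′ ++ y) ∷_) eq′)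
    (s≤s (halve (length P′) _ (≤-trans n (≤-trans (+-mono-≤ u′≤4 (φ≤1 y)) (m≤m+n 5 2)))))
    bound (Long-⊔ (u ++ y) (Long-++ u y (Long-chunk y)) (Long-one (u ++ y) pos))
  where
  m = length (chunk y)
  w = length u′
  Long-one : ∀ G → 1 ≤ length G → Long 1 G
  Long-one (c ∷ G) _ = Long-1 c G
  open ≤-Reasoning
  bound : length (chunk (u′ ++ y)) + size P′ < w + ((m ⊔ 1) + ((m ⊔ 1) + (m ⊔ 1)))
  bound = begin-strict
    length (chunk (u′ ++ y)) + size P′ ≡⟨ +-comm (length (chunk (u′ ++ y))) (size P′) ⟩
    size P′ + length (chunk (u′ ++ y)) ≡⟨ s ⟩
    w + m                              <⟨ n<1+n (w + m) ⟩
    suc (w + m)                        ≡⟨ trans (cong suc (+-comm w m)) (+-comm (suc m) w) ⟩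
    w + suc m                          ≡⟨ cong (w +_) (+-comm 1 m) ⟩
    w + (m + 1)                        ≤⟨ +-monoʳ-≤ w (+-mono-≤ (m≤m⊔n m 1) (≤-trans (m≤n⊔m m 1) (m≤m+n _ _))) ⟩
    w + ((m ⊔ 1) + ((m ⊔ 1) + (m ⊔ 1)))      ∎

edit-window : ∀ x u u′ y → length u′ ≤ 4 → 1 ≤ length (x ++ u ++ y) →
  Window (length u′) (x ++ u ++ y) (x ++ u′ ++ y)
edit-window []      u u′ y u′≤4 pos = window-start u u′ y u′≤4 pos
edit-window (x ∷ xs) u u′ y u′≤4 _   = phase⇒window (phase u u′ y u′≤4 x xs)

-- Total length of the set of distinct factors

size-++ : ∀ Ds Es → size (Ds ++ Es) ≡ size Ds + size Es
size-++ Ds Es = trans (cong sum (map-++ length Ds Es)) (sum-++ (map length Ds) (map length Es))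

∈-delete : ∀ {D E : Str} As Bs → D ≢ E → D ∈ As ++ E ∷ Bs → D ∈ As ++ Bs
∈-delete []       Bs ne (here eq) = ⊥-elim (ne eq)
∈-delete []       Bs ne (there i) = i
∈-delete (A ∷ As) Bs ne (here eq) = here eq
∈-delete (A ∷ As) Bs ne (there i) = there (∈-delete As Bs ne i)

size-⊆ : ∀ Ds Es → Unique Ds → (∀ {D} → D ∈ Ds → D ∈ Es) → size Ds ≤ size Es
size-⊆ []       Es _        incl = z≤n
size-⊆ (D ∷ Ds) Es (d ∷ us) incl with ∈-∃++ (incl (here refl))
... | As , Bs , refl = begin
  length D + size Ds              ≤⟨ +-monoʳ-≤ (length D) (size-⊆ Ds (As ++ Bs) us incl′) ⟩
  length D + size (As ++ Bs)      ≡⟨ cong (length D +_) (size-++ As Bs) ⟩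
  length D + (size As + size Bs)  ≡⟨ swap (length D) (size As) (size Bs) ⟩
  size As + (length D + size Bs)  ≡⟨ size-++ As (D ∷ Bs) ⟨
  size (As ++ D ∷ Bs)             ∎
  where
  open ≤-Reasoning
  incl′ : ∀ {E} → E ∈ Ds → E ∈ As ++ Bs
  incl′ i = ∈-delete As Bs (≢-sym (All.lookup d i)) (incl (there i))
  swap : ∀ a b c → a + (b + c) ≡ b + (a + c)
  swap a b c = trans (sym (+-assoc a b c)) (trans (cong (_+ c) (+-comm a b)) (+-assoc b a c))

∈-distinct⁺ : ∀ G {D} → D ∈ factors G → D ∈ distinct G
∈-distinct⁺ G = ∈-deduplicate⁺ (≡-dec _≟_)

∈-distinct⁻ : ∀ G {D} → D ∈ distinct G → D ∈ factors G
∈-distinct⁻ G = ∈-deduplicate⁻ (≡-dec _≟_) (factors G)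

distinct-unique : ∀ G → Unique (distinct G)
distinct-unique G = deduplicate-! (≡-dec _≟_) (factors G)

dictSize≤length : ∀ G → dictSize G ≤ length G
dictSize≤length G = ≤-trans (size-⊆ (distinct G) (factors G) (distinct-unique G) (∈-distinct⁻ G))
                            (≤-reflexive (size-factors G))

dictSize-one : ∀ G {D} → D ∈ factors G → length D ≤ dictSize G
dictSize-one G {D} i = subst (_≤ dictSize G) (+-identityʳ _)
  (size-⊆ (D ∷ []) (distinct G) ([] ∷ []) λ { (here refl) → ∈-distinct⁺ G i })

dictSize-two : ∀ G {D E} → D ∈ factors G → E ∈ factors G → D ≢ E → length D + length E ≤ dictSize G
dictSize-two G {D} {E} i j ne = subst (λ k → length D + k ≤ dictSize G) (+-identityʳ _)
  (size-⊆ (D ∷ E ∷ []) (distinct G) ((ne ∷ []) ∷ [] ∷ [])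
    λ { (here refl) → ∈-distinct⁺ G i ; (there (here refl)) → ∈-distinct⁺ G j })

-- Factors of `G′` outside the window occur in `G`, so only the window can add to the dictionary.
dictSize-window : ∀ G G′ As Bs Bs′ Cs → factors G ≡ As ++ Bs ++ Cs → factors G′ ≡ As ++ Bs′ ++ Cs →
  dictSize G′ ≤ dictSize G + size Bs′
dictSize-window G G′ As Bs Bs′ Cs eq eq′ = ≤-trans
  (size-⊆ (distinct G′) (distinct G ++ Bs′) (distinct-unique G′) (λ {D} i → place (subst (D ∈_) eq′ (∈-distinct⁻ G′ i))))
  (≤-reflexive (size-++ (distinct G) Bs′))
  where
  known : ∀ {D} → D ∈ As ++ Bs ++ Cs → D ∈ distinct G ++ Bs′
  known {D} i = ∈-++⁺ˡ (∈-distinct⁺ G (subst (D ∈_) (sym eq) i))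
  place : ∀ {D} → D ∈ As ++ Bs′ ++ Cs → D ∈ distinct G ++ Bs′
  place i with ∈-++⁻ As i
  ... | inj₁ a = known (∈-++⁺ˡ a)
  ... | inj₂ r with ∈-++⁻ Bs′ r
  ...   | inj₁ b = ∈-++⁺ʳ (distinct G) b
  ...   | inj₂ c = known (∈-++⁺ʳ As (∈-++⁺ʳ Bs c))

-- Invariance of the size under order-preserving renamings

Compat : (ℕ → ℕ → Set) → Set
Compat R = ∀ {a a′ b b′} → R a a′ → R b b′ → (a <ᵇ b) ≡ (a′ <ᵇ b′)

<ᵇ-false⁻ : ∀ {m n} → (m <ᵇ n) ≡ false → n ≤ m
<ᵇ-false⁻ {m} {n} eq = ≮⇒≥ λ p → true≢false (trans (sym (<ᵇ-true p)) eq)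
  where true≢false : true ≢ false
        true≢false ()

Compat-flip : ∀ {R} → Compat R → Compat (flip R)
Compat-flip R-compat r s = sym (R-compat r s)

-- Agreement on the strict order in both directions forces agreement on equality, by antisymmetry.
Compat-injective : ∀ {R} → Compat R → ∀ {a a′ b b′} → R a a′ → R b b′ → a ≡ b → a′ ≡ b′
Compat-injective R-compat {a} r s refl = ≤-antisym
  (<ᵇ-false⁻ (trans (sym (R-compat s r)) (<ᵇ-false (≤-refl {a}))))
  (<ᵇ-false⁻ (trans (sym (R-compat r s)) (<ᵇ-false (≤-refl {a}))))

module _ {R : ℕ → ℕ → Set} (R-compat : Compat R) where

  lexLt-cong : ∀ {D D′ E E′} → Pointwise R D D′ → Pointwise R E E′ → lexLt D E ≡ lexLt D′ E′
  lexLt-cong []       []       = refl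
  lexLt-cong []       (_ ∷ _)  = refl
  lexLt-cong (_ ∷ _)  []       = refl
  lexLt-cong (r ∷ rs) (s ∷ ss) rewrite R-compat r s | R-compat s r | lexLt-cong rs ss = refl

  typ-cong : ∀ {G G′} → Pointwise R G G′ → typ G ≡ typ G′
  typ-cong []       = refl
  typ-cong (r ∷ rs) = lexLt-cong (r ∷ rs) rs

  closes-cong : ∀ {c c′ G G′} → R c c′ → Pointwise R G G′ → closes c G ≡ closes c′ G′
  closes-cong r rs = cong₂ (λ a b → a ∧ not b) (typ-cong rs) (typ-cong (r ∷ rs))

  parts-cong : ∀ {G G′} → Pointwise R G G′ → Pointwise (Pointwise R) (parts G) (parts G′)
  parts-cong []       = [] ∷ []
  parts-cong (_∷_ {x = c} {y = c′} {xs = G} {ys = G′} r rs)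
    with closes c G | closes c′ G′ | closes-cong r rs | parts-cong rs
  ... | true  | true  | _ | ps     = (r ∷ []) ∷ ps
  ... | false | false | _ | p ∷ ps = (r ∷ p) ∷ ps

  factors-cong : ∀ {G G′} → Pointwise R G G′ → Pointwise (Pointwise R) (factors G) (factors G′)
  factors-cong []       = []
  factors-cong (_∷_ {x = c} {y = c′} {xs = G} {ys = G′} r rs) =
    subst₂ (Pointwise (Pointwise R)) (sym (factors-parse c G)) (sym (factors-parse c′ G′)) (parts-cong (r ∷ rs))

  pointwise-injective : ∀ {D D′ E E′} → Pointwise R D D′ → Pointwise R E E′ → D ≡ E → D′ ≡ E′
  pointwise-injective []       []       refl = refl
  pointwise-injective (r ∷ rs) (s ∷ ss) refl =
    cong₂ _∷_ (Compat-injective {R} R-compat r s refl) (pointwise-injective rs ss refl)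

flip-pointwise : ∀ {R : ℕ → ℕ → Set} {D D′} → Pointwise R D D′ → Pointwise (flip R) D′ D
flip-pointwise = PW.symmetric id

-- The relation preserves equality of factors in both directions, so the same positions are filtered
-- out.
deduplicate-cong : ∀ {R : ℕ → ℕ → Set} → Compat R → ∀ {Ds Ds′} → Pointwise (Pointwise R) Ds Ds′ →
  Pointwise (Pointwise R) (deduplicate (≡-dec _≟_) Ds) (deduplicate (≡-dec _≟_) Ds′)
deduplicate-cong {R} R-compat []       = []
deduplicate-cong {R} R-compat (p ∷ ps) = p ∷ PW.filter⁺ _ _
  (λ q ne eq → ne (pointwise-injective {flip R} (Compat-flip {R} R-compat) (flip-pointwise p) (flip-pointwise q) eq))
  (λ q ne eq → ne (pointwise-injective {R} R-compat p q eq))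
  (deduplicate-cong {R} R-compat ps)

size-cong : ∀ {R : ℕ → ℕ → Set} {Ds Ds′} → Pointwise (Pointwise R) Ds Ds′ → size Ds ≡ size Ds′
size-cong []       = refl
size-cong (p ∷ ps) = cong₂ _+_ (Pointwise-length p) (size-cong ps)

lexLt-irrefl : ∀ D → lexLt D D ≡ false
lexLt-irrefl []      = refl
lexLt-irrefl (x ∷ D) rewrite <ᵇ-false (≤-refl {x}) = lexLt-irrefl D

-- Inductive form of `lexLt`, on which transitivity and trichotomy follow by case analysis.
data LexLt : Str → Str → Set where
  nil  : ∀ {y E} → LexLt [] (y ∷ E)
  less : ∀ {x y D E} → x < y → LexLt (x ∷ D) (y ∷ E)
  same : ∀ {x D E} → LexLt D E → LexLt (x ∷ D) (x ∷ E)

lexLt⇒LexLt : ∀ D E → lexLt D E ≡ true → LexLt D E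
lexLt⇒LexLt []      (y ∷ E) _  = nil
lexLt⇒LexLt (x ∷ D) (y ∷ E) eq with <-cmp x y
... | tri< p _ _    = less p
lexLt⇒LexLt (x ∷ D) (y ∷ E) eq | tri≈ _ refl _ rewrite <ᵇ-false (≤-refl {x}) = same (lexLt⇒LexLt D E eq)
lexLt⇒LexLt (x ∷ D) (y ∷ E) eq | tri> _ _ p rewrite <ᵇ-false (<⇒≤ p) | <ᵇ-true p with () ← eq

LexLt⇒lexLt : ∀ {D E} → LexLt D E → lexLt D E ≡ true
LexLt⇒lexLt nil      = refl
LexLt⇒lexLt (less p) rewrite <ᵇ-true p = refl
LexLt⇒lexLt (same {x} l) rewrite <ᵇ-false (≤-refl {x}) = LexLt⇒lexLt l

LexLt-trans : ∀ {C D E} → LexLt C D → LexLt D E → LexLt C E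
LexLt-trans nil      (less _) = nil
LexLt-trans nil      (same _) = nil
LexLt-trans (less p) (less q) = less (<-trans p q)
LexLt-trans (less p) (same _) = less p
LexLt-trans (same _) (less q) = less q
LexLt-trans (same l) (same k) = same (LexLt-trans l k)

LexLt-tri : ∀ D E → LexLt D E ⊎ D ≡ E ⊎ LexLt E D
LexLt-tri []      []      = inj₂ (inj₁ refl)
LexLt-tri []      (y ∷ E) = inj₁ nil
LexLt-tri (x ∷ D) []      = inj₂ (inj₂ nil)
LexLt-tri (x ∷ D) (y ∷ E) with <-cmp x y
... | tri< p _ _    = inj₁ (less p)
... | tri> _ _ p    = inj₂ (inj₂ (less p))
... | tri≈ _ refl _ with LexLt-tri D E
...   | inj₁ l           = inj₁ (same l)
...   | inj₂ (inj₁ refl) = inj₂ (inj₁ refl)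
...   | inj₂ (inj₂ l)    = inj₂ (inj₂ (same l))

count-mono : ∀ L (p q : Str → Bool) → (∀ D → p D ≡ true → q D ≡ true) → count L p ≤ count L q
count-mono []      p q imp = z≤n
count-mono (D ∷ L) p q imp with p D in eq
... | true  rewrite imp D eq = s≤s (count-mono L p q imp)
... | false with q D
...   | true  = m≤n⇒m≤1+n (count-mono L p q imp)
...   | false = count-mono L p q imp

count-strict : ∀ L (p q : Str → Bool) → (∀ D → p D ≡ true → q D ≡ true) →
  ∀ {D} → D ∈ L → p D ≡ false → q D ≡ true → count L p < count L q
count-strict (D ∷ L) p q imp (here refl) pf qt rewrite pf | qt = s≤s (count-mono L p q imp)
count-strict (D ∷ L) p q imp (there i)   pf qt with p D in eq
... | true  rewrite imp D eq = s≤s (count-strict L p q imp i pf qt)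
... | false with q D
...   | true  = m≤n⇒m≤1+n (count-strict L p q imp i pf qt)
...   | false = count-strict L p q imp i pf qt

-- `rename b G` is `rank b (distinct G)`. Here the list is arbitrary and may contain repetitions, so
-- that the factors of two strings can be ranked jointly.
rank : ℕ → List Str → Str → ℕ
rank b L D = b + count L (λ D′ → lexLt D′ D)

-- Everything below `D` is below `E`, and `D` itself is counted only for `E`.
rank-< : ∀ b {L D E} → D ∈ L → LexLt D E → rank b L D < rank b L E
rank-< b {L} {D} {E} i l = +-monoʳ-< b (count-strict L _ _
  (λ C eq → LexLt⇒lexLt (LexLt-trans (lexLt⇒LexLt C D eq) l)) i (lexLt-irrefl D) (LexLt⇒lexLt l))

lexLt-false : ∀ {D E} → LexLt E D → lexLt D E ≡ false
lexLt-false {D} {E} l with lexLt D E in eq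
... | false = refl
... | true  with trans (sym (lexLt-irrefl D)) (LexLt⇒lexLt (LexLt-trans (lexLt⇒LexLt D E eq) l))
...   | ()

rank-<ᵇ : ∀ b {L D E} → D ∈ L → E ∈ L → (rank b L D <ᵇ rank b L E) ≡ lexLt D E
rank-<ᵇ b {L} {D} {E} i j with LexLt-tri D E
... | inj₁ l           = trans (<ᵇ-true (rank-< b i l)) (sym (LexLt⇒lexLt l))
... | inj₂ (inj₁ refl) = trans (<ᵇ-false (≤-refl {rank b L D})) (sym (lexLt-irrefl D))
... | inj₂ (inj₂ l)    = trans (<ᵇ-false (<⇒≤ (rank-< b j l))) (sym (lexLt-false l))

-- Relates the symbols that two rankings give to factors related by `Q`, which is either a
-- symbolwise renaming or equality.
Ranks : (Str → Str → Set) → (b b′ : ℕ) (L L′ : List Str) → ℕ → ℕ → Set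
Ranks Q b b′ L L′ r r′ = ∃[ D ] ∃[ D′ ]
  D ∈ L × D′ ∈ L′ × Q D D′ × r ≡ rank b L D × r′ ≡ rank b′ L′ D′

Ranks-compat : ∀ {Q} b b′ L L′ → (∀ {D D′ E E′} → Q D D′ → Q E E′ → lexLt D E ≡ lexLt D′ E′) →
  Compat (Ranks Q b b′ L L′)
Ranks-compat b b′ L L′ Q-compat (D , D′ , i , i′ , q , refl , refl) (E , E′ , j , j′ , s , refl , refl) =
  trans (rank-<ᵇ b i j) (trans (Q-compat q s) (sym (rank-<ᵇ b′ i′ j′)))

Ranks-map : ∀ {Q} b b′ L L′ {Ds Ds′} → (∀ {D} → D ∈ Ds → D ∈ L) → (∀ {D} → D ∈ Ds′ → D ∈ L′) →
  Pointwise Q Ds Ds′ → Pointwise (Ranks Q b b′ L L′) (map (rank b L) Ds) (map (rank b′ L′) Ds′)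
Ranks-map b b′ L L′ incl incl′ []       = []
Ranks-map b b′ L L′ incl incl′ (q ∷ qs) =
  (_ , _ , incl (here refl) , incl′ (here refl) , q , refl , refl)
  ∷ Ranks-map b b′ L L′ (incl ∘ there) (incl′ ∘ there) qs

continues⇒2≤ : ∀ G → continues G ≡ true → 2 ≤ length (factors G)
continues⇒2≤ G eq = ≤ᵇ⇒≤ 2 _ (subst T (trans (sym eq) (continues-factors G)) _)

factors-shorter : ∀ G → continues G ≡ true → length (factors G) < length G
factors-shorter G eq = ≤-pred (begin
  2 + z        ≤⟨ +-monoˡ-≤ z (continues⇒2≤ G eq) ⟩
  z + z        ≡⟨ cong (z +_) (+-identityʳ z) ⟨
  2 * z        ≡⟨ *-comm 2 z ⟩
  z * 2        ≤⟨ length-factors G ⟩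
  suc (length G) ∎)
  where
  z = length (factors G)
  open ≤-Reasoning

next-length : ∀ b G → length (next b G) ≡ length (factors G)
next-length b G = length-map (rename b G) (factors G)

next-fits : ∀ {f} b G → continues G ≡ true → length G ≤ suc f → length (next b G) ≤ f
next-fits b G eq le rewrite next-length b G = ≤-pred (≤-trans (factors-shorter G eq) le)

gisGo-[] : ∀ f b → gisGo f b [] ≡ 0
gisGo-[] zero    b = refl
gisGo-[] (suc f) b = refl

-- Related strings have related parsings, and ranking these yields an order-preserving relation on
-- the next level. Fuel and base do not affect the value, as long as the fuel is at least the
-- length.
gisGo-cong : ∀ {R} → Compat R → ∀ f f′ b b′ {G G′} → length G ≤ f → length G′ ≤ f′ →
  Pointwise R G G′ → gisGo f b G ≡ gisGo f′ b′ G′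
gisGo-cong R-compat f f′ b b′ le le′ [] = trans (gisGo-[] f b) (sym (gisGo-[] f′ b′))
gisGo-cong {R} R-compat (suc f) (suc f′) b b′ {G} {G′} le le′ ps@(_ ∷ _)
  with continues G in eq | continues G′ in eq′
     | trans (continues-factors G) (trans (cong (2 ≤ᵇ_) (Pointwise-length (factors-cong R-compat ps))) (sym (continues-factors G′)))
... | false | false | _ = Pointwise-length ps
... | true  | true  | _ = cong₂ _+_
  (size-cong (deduplicate-cong R-compat (factors-cong R-compat ps)))
  (gisGo-cong (Ranks-compat b b′ (distinct G) (distinct G′) (lexLt-cong R-compat)) f f′ _ _
    (next-fits b G eq le) (next-fits b′ G′ eq′ le′)
    (Ranks-map b b′ (distinct G) (distinct G′) (∈-distinct⁺ G) (∈-distinct⁺ G′) (factors-cong R-compat ps)))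
... | true  | false | ()
... | false | true  | ()

-- Replaces the ranking among a string's own factors by one in a larger list. With `L` common to two
-- strings, equal factors get equal symbols in both.
gisGo-rank : ∀ f b b₀ L G → (∀ {D} → D ∈ factors G → D ∈ L) → length (factors G) ≤ f →
  gisGo f b (next b₀ G) ≡ gisGo f 0 (map (rank 0 L) (factors G))
gisGo-rank f b b₀ L G incl le = gisGo-cong
  (Ranks-compat {_≡_} b₀ 0 (distinct G) L (λ { refl refl → refl })) f f b 0
  (≤-trans (≤-reflexive (next-length b₀ G)) le)
  (≤-trans (≤-reflexive (length-map (rank 0 L) (factors G))) le)
  (Ranks-map {_≡_} b₀ 0 (distinct G) L (∈-distinct⁺ G) incl (PW.refl refl))

-- Size bounds from the length alone

Bounded : ℕ → ℕ → Set
Bounded N B = ∀ f b G → length G ≤ N → gisGo f b G ≤ B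

half-≤ : ∀ {z M N} → z * 2 ≤ suc N → N ≤ M * 2 → z ≤ M
half-≤ {z} {M} p q with z ≤? M
... | yes r = r
... | no  r = ⊥-elim (<⇒≱ (*-monoˡ-≤ 2 (≰⇒> r)) (≤-trans p (s≤s q)))

-- A level costs at most its length, and the next string is at most half as long, rounded up.
bounded-half : ∀ N {M B} → N ≤ M * 2 → Bounded M B → Bounded N (N + B)
bounded-half N h bd zero    b G le = ≤-trans le (m≤m+n N _)
bounded-half N h bd (suc f) b G le with continues G
... | false = ≤-trans le (m≤m+n N _)
... | true  = +-mono-≤ (≤-trans (dictSize≤length G) le)
  (bd f _ (next b G) (≤-trans (≤-reflexive (next-length b G))
    (half-≤ {N = N} (≤-trans (length-factors G) (s≤s le)) h)))

bounded-2 : Bounded 2 2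
bounded-2 zero    b G le = le
bounded-2 (suc f) b G le with continues G in eq
... | false = le
... | true  = ⊥-elim (<⇒≱ (*-monoˡ-≤ 2 (continues⇒2≤ G eq)) (≤-trans (length-factors G) (s≤s le)))

bounded-3 : Bounded 3 5
bounded-3 = bounded-half 3 (n≤1+n 3) bounded-2

bounded-4 : Bounded 4 6
bounded-4 = bounded-half 4 ≤-refl bounded-2

bounded-5 : Bounded 5 10
bounded-5 = bounded-half 5 (n≤1+n 5) bounded-3

bounded-6 : Bounded 6 11
bounded-6 = bounded-half 6 ≤-refl bounded-3

bounded-7 : Bounded 7 13
bounded-7 = bounded-half 7 (n≤1+n 7) bounded-4

bounded-8 : Bounded 8 14
bounded-8 = bounded-half 8 ≤-refl bounded-4

≤-⌈/2⌉ : ∀ n → n ≤ ⌈ n /2⌉ * 2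
≤-⌈/2⌉ zero          = z≤n
≤-⌈/2⌉ (suc zero)    = s≤s z≤n
≤-⌈/2⌉ (suc (suc n)) = s≤s (s≤s (≤-⌈/2⌉ n))

⌈/2⌉-≤ : ∀ n → ⌈ n /2⌉ * 2 ≤ suc n
⌈/2⌉-≤ zero          = z≤n
⌈/2⌉-≤ (suc zero)    = ≤-refl
⌈/2⌉-≤ (suc (suc n)) = s≤s (s≤s (⌈/2⌉-≤ n))

-- The bound (5N - 5)/2 is compatible with the halving recursion once N is at least 5; the smaller
-- lengths are base cases, and at N = 3 it equals the value 5 found there.
bounded-linear : ∀ N → 2 ≤ N → ∃[ B ] (Bounded N B × B * 2 + 5 ≤ 5 * N)
bounded-linear = <-rec _ go
  where
  go : ∀ N → (∀ {M} → M < N → 2 ≤ M → ∃[ B ] (Bounded M B × B * 2 + 5 ≤ 5 * M)) →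
    2 ≤ N → ∃[ B ] (Bounded N B × B * 2 + 5 ≤ 5 * N)
  go 0 _ ()
  go 1 _ (s≤s ())
  go 2 _ _ = 2 , bounded-2 , n≤1+n 9
  go 3 _ _ = 5 , bounded-3 , ≤-refl
  go 4 _ _ = 6 , bounded-4 , m≤m+n 17 3
  go N@(suc (suc (suc (suc (suc n))))) rec _ = extend (rec M<N 2≤M)
    where
    M = ⌈ N /2⌉
    M<N : M < N
    M<N = ⌈n/2⌉<n (3 + n)
    2≤M : 2 ≤ M
    2≤M = s≤s (s≤s z≤n)
    extend : _ → _
    extend (B , bd , le) = N + B , bounded-half N (≤-⌈/2⌉ N) bd , *-cancelʳ-≤ _ _ 2 (begin
      ((N + B) * 2 + 5) * 2      ≡⟨ e₁ N B ⟩
      4 * N + (B * 2 + 5) * 2    ≤⟨ +-monoʳ-≤ (4 * N) (*-monoˡ-≤ 2 le) ⟩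
      4 * N + 5 * M * 2          ≡⟨ cong (4 * N +_) (*-assoc 5 M 2) ⟩
      4 * N + 5 * (M * 2)        ≤⟨ +-monoʳ-≤ (4 * N) (*-monoʳ-≤ 5 (⌈/2⌉-≤ N)) ⟩
      4 * N + 5 * suc N          ≡⟨ e₂ N ⟩
      9 * N + 5                  ≤⟨ +-monoʳ-≤ (9 * N) (m≤m+n 5 n) ⟩
      9 * N + N                  ≡⟨ e₃ N ⟩
      5 * N * 2                  ∎)
      where
      open ≤-Reasoning
      e₁ : ∀ N B → ((N + B) * 2 + 5) * 2 ≡ 4 * N + (B * 2 + 5) * 2
      e₁ = solve-∀
      e₂ : ∀ N → 4 * N + 5 * suc N ≡ 9 * N + 5
      e₂ = solve-∀
      e₃ : ∀ N → 9 * N + N ≡ 5 * N * 2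
      e₃ = solve-∀

bounded-by : ∀ N X → 2 ≤ N → 5 * N ≤ X * 2 + 5 → Bounded N X
bounded-by N X 2≤N h f b G le with bounded-linear N 2≤N
... | B , bd , lin = ≤-trans (bd f b G le)
  (*-cancelʳ-≤ B X 2 (+-cancelʳ-≤ 5 _ _ (≤-trans lin h)))

bounded-1+ : ∀ n → 1 ≤ n → Bounded (1 + n) (4 * n)
bounded-1+ n 1≤n = bounded-by (1 + n) (4 * n) (s≤s 1≤n) (begin
  5 * (1 + n)           ≤⟨ m≤m+n _ (3 * n) ⟩
  5 * (1 + n) + 3 * n   ≡⟨ e n ⟩
  4 * n * 2 + 5         ∎)
  where
  open ≤-Reasoning
  e : ∀ n → 5 * (1 + n) + 3 * n ≡ 4 * n * 2 + 5
  e = solve-∀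

bounded-4+ : ∀ n → 2 ≤ n → Bounded (4 + n) (4 * n + 3)
bounded-4+ 0 ()
bounded-4+ 1 (s≤s ())
-- The linear bound gives no better than 12 at length 6, while 11 is needed.
bounded-4+ 2 _ = bounded-6
bounded-4+ (suc (suc (suc k))) _ = bounded-by (7 + k) (4 * (3 + k) + 3) (s≤s (s≤s z≤n)) (begin
  5 * (7 + k)                ≤⟨ m≤m+n _ (3 * k) ⟩
  5 * (7 + k) + 3 * k        ≡⟨ e k ⟩
  (4 * (3 + k) + 3) * 2 + 5  ∎)
  where
  open ≤-Reasoning
  e : ∀ k → 5 * (7 + k) + 3 * k ≡ (4 * (3 + k) + 3) * 2 + 5
  e = solve-∀

bounded-4+′ : ∀ n → 4 ≤ n → Bounded (4 + n) (4 * n)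
bounded-4+′ (suc (suc (suc (suc zero)))) _ f b G le = ≤-trans (bounded-8 f b G le) (m≤m+n 14 2)
bounded-4+′ (suc (suc (suc (suc (suc k))))) _ = bounded-by (9 + k) (4 * (5 + k)) (s≤s (s≤s z≤n)) (begin
  5 * (9 + k)                ≤⟨ m≤m+n _ (3 * k) ⟩
  5 * (9 + k) + 3 * k        ≡⟨ e k ⟩
  4 * (5 + k) * 2 + 5        ∎)
  where
  open ≤-Reasoning
  e : ∀ k → 5 * (9 + k) + 3 * k ≡ 4 * (5 + k) * 2 + 5
  e = solve-∀
bounded-4+′ 0 ()
bounded-4+′ 1 (s≤s ())
bounded-4+′ 2 (s≤s (s≤s ()))
bounded-4+′ 3 (s≤s (s≤s (s≤s ())))

bounded-4+6 : ∀ n → Bounded (4 + n) (4 * n + 6)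
bounded-4+6 0 = bounded-4
bounded-4+6 1 = bounded-5
bounded-4+6 (suc (suc k)) f b G le =
  ≤-trans (bounded-4+ (2 + k) (s≤s (s≤s z≤n)) f b G le) (+-monoʳ-≤ (4 * (2 + k)) (m≤m+n 3 3))

-- One level of the recursion on two strings

gisGo-stop : ∀ f b G → continues G ≡ false → gisGo f b G ≡ length G
gisGo-stop zero    b G _ = refl
gisGo-stop (suc f) b G eq rewrite eq = refl

gisGo-continue : ∀ f b G → continues G ≡ true →
  gisGo (suc f) b G ≡ dictSize G + gisGo f (b + length (distinct G)) (next b G)
gisGo-continue f b G eq rewrite eq = refl

-- A single factor is the whole string. This lets `unfold′` treat a stopping and a continuing `G′`
-- alike.
stop-length : ∀ G → continues G ≡ false → length G ≤ dictSize G
stop-length []      _  = z≤n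
stop-length (c ∷ G) eq = begin
  length (c ∷ G)          ≡⟨ size-factors (c ∷ G) ⟨
  size (factors (c ∷ G))  ≡⟨ cong size (factors-parse c G) ⟩
  size (parts (c ∷ G))    ≡⟨ lone (closed (c ∷ G)) (subst (λ Ds → (2 ≤ᵇ length Ds) ≡ false) (factors-parse c G) (trans (sym (continues-factors (c ∷ G))) eq)) ⟩
  length (chunk (c ∷ G))  ≤⟨ dictSize-one (c ∷ G) (subst (chunk (c ∷ G) ∈_) (sym (factors-parse c G)) (here refl)) ⟩
  dictSize (c ∷ G)        ∎
  where
  open ≤-Reasoning
  lone : ∀ Ds → (2 ≤ᵇ suc (length Ds)) ≡ false → length (chunk (c ∷ G)) + size Ds ≡ length (chunk (c ∷ G))
  lone []      _ = +-identityʳ _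
  lone (_ ∷ _) ()

const-closed : ∀ {e} es → All (_≡ e) es → typ es ≡ false × closed es ≡ []
const-closed []            []                = refl , refl
const-closed (e ∷ [])      (refl ∷ [])       = refl , refl
const-closed (e ∷ e ∷ es)  (refl ∷ refl ∷ p) with const-closed (e ∷ es) (refl ∷ p)
... | t , c = trans (typ-same e es) t ,
  trans (closed-open e (e ∷ es) (closes-above-L e (e ∷ es) t)) c

-- A constant string has only positions of type L, and no symbol closes in front of one.
const-stop : ∀ {e} r es → All (_≡ e) es → continues (r ∷ es) ≡ false
const-stop r es p with const-closed es p
... | t , c = trans (continues-factors (r ∷ es)) (cong (λ Ds → 2 ≤ᵇ length Ds)
  (trans (factors-parse r es) (cong (chunk (r ∷ es) ∷_) (trans (closed-open r es (closes-above-L r es t)) c))))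

-- Only the length of the window of G′ matters.
Near : ℕ → Str → Str → Set
Near w G G′ = ∃[ x ] ∃[ u ] ∃[ u′ ] ∃[ y ] (G ≡ x ++ u ++ y × G′ ≡ x ++ u′ ++ y × length u′ ≤ w)

near-length : ∀ {w G G′} → Near w G G′ → length G′ ≤ w + length G
near-length {w} (x , u , u′ , y , refl , refl , le) = begin
  length (x ++ u′ ++ y)                  ≡⟨ len x u′ y ⟩
  length x + (length u′ + length y)      ≡⟨ swap (length x) (length u′) (length y) ⟩
  length u′ + (length x + length y)      ≤⟨ +-mono-≤ le (+-monoʳ-≤ (length x) (m≤n+m _ (length u))) ⟩
  w + (length x + (length u + length y)) ≡⟨ cong (w +_) (len x u y) ⟨
  w + length (x ++ u ++ y)               ∎
  where
  open ≤-Reasoning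
  swap : ∀ a b c → a + (b + c) ≡ b + (a + c)
  swap = solve-∀
  len : ∀ (x u y : Str) → length (x ++ u ++ y) ≡ length x + (length u + length y)
  len x u y = trans (length-++ x) (cong (length x +_) (length-++ u))

near-map : ∀ {ρ : Str → ℕ} {Ds Ds′} As Bs Bs′ Cs → Ds ≡ As ++ Bs ++ Cs → Ds′ ≡ As ++ Bs′ ++ Cs →
  length Bs′ ≤ 4 → Near 4 (map ρ Ds) (map ρ Ds′)
near-map {ρ} As Bs Bs′ Cs refl refl le =
  map ρ As , map ρ Bs , map ρ Bs′ , map ρ Cs , maps As Bs Cs , maps As Bs′ Cs ,
  ≤-trans (≤-reflexive (length-map ρ Bs′)) le
  where
  maps : ∀ As Bs Cs → map ρ (As ++ Bs ++ Cs) ≡ map ρ As ++ map ρ Bs ++ map ρ Cs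
  maps As Bs Cs = trans (map-++ ρ As (Bs ++ Cs)) (cong (map ρ As ++_) (map-++ ρ Bs Cs))

-- `H` and `H′` are the next strings, named by one joint ranking `ρ`, and `D` is the factor whose
-- length serves as M. `unfold′` asks for a bound on `H′` only if `H′` fits the fuel, and it also
-- covers the case that the recursion on `G′` stops.
record Step (w f f′ b b′ : ℕ) (G G′ : Str) : Set where
  field
    ρ       : Str → ℕ
    D       : Str
    D∈      : D ∈ factors G
  H  = map ρ (factors G)
  H′ = map ρ (factors G′)
  field
    near    : Near 4 H H′
    dict    : dictSize G′ < dictSize G + (w + (length D + (length D + length D)))
    fits    : length H ≤ f
    unfold  : gisGo (suc f) b G ≡ dictSize G + gisGo f 0 H
    unfold′ : ∀ X → (length H′ ≤ f′ → gisGo f′ 0 H′ ≤ X) → gisGo (suc f′) b′ G′ ≤ dictSize G′ + X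

factors-parts : ∀ G → 1 ≤ length G → factors G ≡ parts G
factors-parts (c ∷ G) _ = factors-parse c G

step : ∀ {w f f′ b b′ G G′} → w ≤ 4 → length G ≤ suc f → length G′ ≤ suc f′ → 1 ≤ length G′ →
  Near w G G′ → continues G ≡ true → Step w f f′ b b′ G G′
step {w} {f} {f′} {b} {b′} {G} {G′} w≤4 le le′ pos′ (x , u , u′ , y , refl , refl , u′≤w) cont = record
  { ρ = rank 0 L ; D = E ; D∈ = E∈
  ; near = near-map {rank 0 L} prefix old new suffix (trans F≡ before) (trans F′≡ after) few
  ; dict = dict
  ; fits = ≤-trans (≤-reflexive (length-map (rank 0 L) (factors G))) fit
  ; unfold = trans (gisGo-continue f b G cont) (cong (dictSize G +_) (gisGo-rank f _ b L G ∈-++⁺ˡ fit))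
  ; unfold′ = unfold′
  }
  where
  pos : 1 ≤ length G
  pos = ≤-trans (s≤s z≤n) (factors-shorter G cont)
  open Window (edit-window x u u′ y (≤-trans u′≤w w≤4) pos)
  L   = factors G ++ factors G′
  F≡  = factors-parts G pos
  F′≡ = factors-parts G′ pos′
  fit : length (factors G) ≤ f
  fit = ≤-pred (≤-trans (factors-shorter G cont) le)
  found = find long
  E   = proj₁ found
  E∈ : E ∈ factors G
  E∈ = subst (E ∈_) (sym F≡) (proj₁ (proj₂ found))
  m≤E : m ≤ length E
  m≤E = proj₂ (proj₂ found)
  dict : dictSize G′ < dictSize G + (w + (length E + (length E + length E)))
  dict = begin-strict
    dictSize G′             ≤⟨ dictSize-window G G′ prefix old new suffix (trans F≡ before) (trans F′≡ after) ⟩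
    dictSize G + size new   <⟨ +-monoʳ-< (dictSize G) small ⟩
    dictSize G + (length u′ + (m + (m + m))) ≤⟨ +-monoʳ-≤ (dictSize G) (+-mono-≤ u′≤w (+-mono-≤ m≤E (+-mono-≤ m≤E m≤E))) ⟩
    dictSize G + (w + (length E + (length E + length E))) ∎
    where open ≤-Reasoning
  unfold′ : ∀ X → (length (map (rank 0 L) (factors G′)) ≤ f′ → gisGo f′ 0 (map (rank 0 L) (factors G′)) ≤ X) →
    gisGo (suc f′) b′ G′ ≤ dictSize G′ + X
  unfold′ X h with continues G′ in eq
  ... | false = ≤-trans (stop-length G′ eq) (m≤m+n _ X)
  ... | true  = +-monoʳ-≤ (dictSize G′)
    (≤-trans (≤-reflexive (gisGo-rank f′ _ b′ L G′ (∈-++⁺ʳ (factors G)) fit′))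
             (h (≤-trans (≤-reflexive (length-map (rank 0 L) (factors G′))) fit′)))
    where
    fit′ : length (factors G′) ≤ f′
    fit′ = ≤-pred (≤-trans (factors-shorter G′ eq) le′)

-- Slack of the dictionary and growth of the size

Shape : Str → Str → Set
Shape G D = 2 + length D ≤ dictSize G
  ⊎ ∃[ E ] (2 ≤ length E × All (_≡ E) (closed G) × (1 + length D ≤ dictSize G ⊎ chunk G ≡ E))

-- A factor different from `D` adds its length to the dictionary, at least 2 if it is not the first.
-- So slack 2 is available unless all factors but the first equal `D`; then only the first, possibly
-- of length 1, can differ.
shape : ∀ G {D} → continues G ≡ true → D ∈ factors G → Shape G D
shape []      ()
shape (c ∷ G) {D} cont D∈F = go (closed (c ∷ G)) refl
  where
  S = c ∷ G
  F≡ : factors S ≡ parts S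
  F≡ = factors-parse c G
  two : ∀ {E E′} → E ∈ parts S → E′ ∈ parts S → E ≢ E′ → length E′ + length E ≤ dictSize S
  two i j ne = dictSize-two S (subst (_ ∈_) (sym F≡) j) (subst (_ ∈_) (sym F≡) i) (≢-sym ne)
  D∈ : D ∈ parts S
  D∈ = subst (D ∈_) F≡ D∈F
  go : ∀ Es → closed S ≡ Es → Shape S D
  go [] eq = ⊥-elim (<⇒≱ (continues⇒2≤ S cont) (≤-reflexive (trans (cong length F≡) (cong (suc ∘ length) eq))))
  go (E ∷ Es) eq = decide (All.all? (λ Z → ≡-dec _≟_ Z E) Es)
    where
    long′ : All (λ Z → 2 ≤ length Z) (E ∷ Es)
    long′ = subst (All _) eq (closed-long S)
    in-parts : ∀ {Z} → Z ∈ E ∷ Es → Z ∈ parts S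
    in-parts i = there (subst (_ ∈_) (sym eq) i)
    beside : ∀ {Z} → Z ∈ E ∷ Es → D ≢ Z → 2 + length D ≤ dictSize S
    beside i ne = ≤-trans (+-monoˡ-≤ (length D) (All.lookup long′ i)) (two D∈ (in-parts i) ne)
    decide : _ → Shape S D
    decide (no ¬all) with find (¬All⇒Any¬ (λ Z → ≡-dec _≟_ Z E) Es ¬all) | ≡-dec _≟_ D E
    ... | Z , i , ne | yes refl = inj₁ (beside (there i) (≢-sym ne))
    ... | _          | no D≢E   = inj₁ (beside (here refl) D≢E)
    decide (yes all) with ≡-dec _≟_ (chunk S) E | ≡-dec _≟_ D E
    ... | yes eq′ | _        = inj₂ (E , All.head long′ , subst (All (_≡ E)) (sym eq) (refl ∷ all) , inj₂ eq′)
    ... | no ne   | yes refl = inj₂ (E , All.head long′ , subst (All (_≡ E)) (sym eq) (refl ∷ all) ,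
      inj₁ (≤-trans (+-monoˡ-≤ (length D) (chunk-nonempty c G)) (two (in-parts (here refl)) (here refl) (≢-sym ne))))
    ... | no _    | no D≢E   = inj₁ (beside (here refl) D≢E)

-- Equal factors get equal symbols, so the next string is constant after its first symbol.
uniform-stop : ∀ (ρ : Str → ℕ) G {E} → 1 ≤ length G → All (_≡ E) (closed G) → continues (map ρ (factors G)) ≡ false
uniform-stop ρ (c ∷ G) {E} _ all = subst (λ Ds → continues (map ρ Ds) ≡ false) (sym (factors-parse c G))
  (const-stop (ρ (chunk (c ∷ G))) (map ρ (closed (c ∷ G))) (map⁺ (All.map (cong ρ) all)))

size-const : ∀ {E} Ds → All (_≡ E) Ds → size Ds ≡ length Ds * length E
size-const []       []         = refl
size-const (D ∷ Ds) (refl ∷ p) = cong (length D +_) (size-const Ds p)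

-- Each unit by which `d` falls below `m` is gained three times, because `d` enters three times.
dict-slack : ∀ j w {k m d} → k < m + (w + (d + (d + d))) → j + d ≤ m → suc k + (j + (j + j)) ≤ 4 * m + w
dict-slack j w {k} {m} {d} lt le = begin
  suc k + (j + (j + j))                      ≤⟨ +-monoˡ-≤ _ lt ⟩
  m + (w + (d + (d + d))) + (j + (j + j))    ≡⟨ e₁ m w d j ⟩
  m + ((j + d) + ((j + d) + (j + d))) + w    ≤⟨ +-monoˡ-≤ w (+-monoʳ-≤ m (+-mono-≤ le (+-mono-≤ le le))) ⟩
  m + (m + (m + m)) + w                      ≡⟨ e₂ m w ⟩
  4 * m + w                                  ∎
  where
  open ≤-Reasoning
  e₁ : ∀ m w d j → m + (w + (d + (d + d))) + (j + (j + j)) ≡ m + ((j + d) + ((j + d) + (j + d))) + w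
  e₁ = solve-∀
  e₂ : ∀ m w → m + (m + (m + m)) + w ≡ 4 * m + w
  e₂ = solve-∀

-- With slack 2 the gain of 6, plus one from strictness, outweighs the window of 4, so the additive
-- 6 is passed on unchanged by the recursion.
near-4-growth : ∀ f f′ b b′ G G′ → length G ≤ f → length G′ ≤ f′ → Near 4 G G′ →
  gisGo f′ b′ G′ ≤ 4 * gisGo f b G + 6
near-4-growth f f′ b b′ G G′ le le′ near with continues G in cont
... | false = subst (λ n → gisGo f′ b′ G′ ≤ 4 * n + 6) (sym (gisGo-stop f b G cont))
  (bounded-4+6 (length G) f′ b′ G′ (near-length near))
near-4-growth f f′ b b′ G [] le le′ near | true = ≤-trans (≤-reflexive (gisGo-[] f′ b′)) z≤n
near-4-growth (suc f) (suc f′) b b′ G@(_ ∷ _) G′@(_ ∷ _) le le′ near | true = finish (shape G cont (Step.D∈ st))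
  where
  st : Step 4 f f′ b b′ G G′
  st = step ≤-refl le le′ (s≤s z≤n) near cont
  open Step st hiding (near)
  d≤ : length D ≤ dictSize G
  d≤ = dictSize-one G D∈
  open ≤-Reasoning
  finish : Shape G D → gisGo (suc f′) b′ G′ ≤ 4 * gisGo (suc f) b G + 6
  finish (inj₁ h) = begin
    gisGo (suc f′) b′ G′                       ≤⟨ unfold′ _ (λ fits′ → near-4-growth f f′ 0 0 H H′ fits fits′ (Step.near st)) ⟩
    dictSize G′ + (4 * gisGo f 0 H + 6)        ≤⟨ +-monoˡ-≤ _ (drop-slack (dict-slack 2 4 dict h)) ⟩
    4 * dictSize G + (4 * gisGo f 0 H + 6)     ≡⟨ e (dictSize G) (gisGo f 0 H) ⟩
    4 * (dictSize G + gisGo f 0 H) + 6         ≡⟨ cong (λ n → 4 * n + 6) unfold ⟨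
    4 * gisGo (suc f) b G + 6                  ∎
    where
    drop-slack : ∀ {k m} → suc k + 6 ≤ m + 4 → k ≤ m
    drop-slack {k} {m} p = ≤-trans (m≤m+n k 3) (+-cancelʳ-≤ 4 _ _ (≤-trans (≤-reflexive (e₀ k)) p))
      where e₀ : ∀ k → k + 3 + 4 ≡ suc k + 6
            e₀ = solve-∀
    e : ∀ a c → 4 * a + (4 * c + 6) ≡ 4 * (a + c) + 6
    e = solve-∀
  -- Here `H` stops and its size is its length. The excess is 4 - 1 = 3 from the dictionary and 3
  -- from `bounded-4+`.
  finish (inj₂ (E , _ , all , _)) = begin
    gisGo (suc f′) b′ G′                       ≤⟨ unfold′ _ (λ _ → bounded-4+ (length H) 2≤H f′ 0 H′ (near-length (Step.near st))) ⟩
    dictSize G′ + (4 * length H + 3)           ≤⟨ +-monoˡ-≤ _ (≤-pred (≤-trans (m≤m+n _ 0) (≤-trans (dict-slack 0 4 dict d≤) (≤-reflexive (+-suc _ 3))))) ⟩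
    4 * dictSize G + 3 + (4 * length H + 3)    ≡⟨ e (dictSize G) (length H) ⟩
    4 * (dictSize G + length H) + 6            ≡⟨ cong (λ n → 4 * (dictSize G + n) + 6) (gisGo-stop f 0 H (uniform-stop ρ G (s≤s z≤n) all)) ⟨
    4 * (dictSize G + gisGo f 0 H) + 6         ≡⟨ cong (λ n → 4 * n + 6) unfold ⟨
    4 * gisGo (suc f) b G + 6                  ∎
    where
    2≤H : 2 ≤ length H
    2≤H = ≤-trans (continues⇒2≤ G cont) (≤-reflexive (sym (length-map ρ (factors G))))
    e : ∀ a c → 4 * a + 3 + (4 * c + 3) ≡ 4 * (a + c) + 6
    e = solve-∀

edit-near : ∀ {T T′} → OneEdit T T′ → Near 1 T T′
edit-near (sub xs ys a b _) = xs , a ∷ [] , b ∷ [] , ys , refl , refl , ≤-refl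
edit-near (ins xs ys b)     = xs , [] , b ∷ [] , ys , refl , refl , ≤-refl
edit-near (del xs ys a)     = xs , a ∷ [] , [] , ys , refl , refl , z≤n

-- With a window of one symbol strictness cancels `w`, and slack `j` leaves three times `j` to
-- spare: 6 for `near-4-growth`, 3 for `bounded-4+`, nothing when `G` is a power of one factor.
near-1-growth : ∀ f f′ b b′ G G′ → 1 ≤ length G → length G ≤ f → length G′ ≤ f′ → Near 1 G G′ →
  gisGo f′ b′ G′ ≤ 4 * gisGo f b G
near-1-growth f f′ b b′ G G′ pos le le′ near with continues G in cont
... | false = subst (λ n → gisGo f′ b′ G′ ≤ 4 * n) (sym (gisGo-stop f b G cont))
  (bounded-1+ (length G) pos f′ b′ G′ (near-length near))
near-1-growth f f′ b b′ G [] pos le le′ near | true = ≤-trans (≤-reflexive (gisGo-[] f′ b′)) z≤n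
near-1-growth (suc f) (suc f′) b b′ G@(_ ∷ _) G′@(_ ∷ _) pos le le′ near | true = finish (shape G cont (Step.D∈ st))
  where
  st : Step 1 f f′ b b′ G G′
  st = step (s≤s z≤n) le le′ (s≤s z≤n) near cont
  open Step st hiding (near)
  m = dictSize G
  n = length H
  d≤ : length D ≤ m
  d≤ = dictSize-one G D∈
  2≤n : 2 ≤ n
  2≤n = ≤-trans (continues⇒2≤ G cont) (≤-reflexive (sym (length-map ρ (factors G))))
  H′-length : length H′ ≤ 4 + n
  H′-length = near-length (Step.near st)
  open ≤-Reasoning

  slack : ∀ j → j + length D ≤ m → dictSize G′ + (j + (j + j)) ≤ 4 * m
  slack j h = ≤-pred (≤-trans (dict-slack j 1 dict h) (≤-reflexive (+-comm (4 * m) 1)))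

  absorb : ∀ j X → j + length D ≤ m → gisGo (suc f′) b′ G′ ≤ dictSize G′ + (X + (j + (j + j))) →
    gisGo (suc f′) b′ G′ ≤ 4 * m + X
  absorb j X h p = begin
    gisGo (suc f′) b′ G′                ≤⟨ p ⟩
    dictSize G′ + (X + (j + (j + j)))   ≡⟨ e (dictSize G′) X (j + (j + j)) ⟩
    dictSize G′ + (j + (j + j)) + X     ≤⟨ +-monoˡ-≤ X (slack j h) ⟩
    4 * m + X                           ∎
    where
    e : ∀ a X c → a + (X + c) ≡ a + c + X
    e = solve-∀

  stopped : ∀ {E} → All (_≡ E) (closed G) → gisGo (suc f′) b′ G′ ≤ 4 * m + 4 * n → gisGo (suc f′) b′ G′ ≤ 4 * gisGo (suc f) b G
  stopped all p = begin
    gisGo (suc f′) b′ G′          ≤⟨ p ⟩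
    4 * m + 4 * n                 ≡⟨ *-distribˡ-+ 4 m n ⟨
    4 * (m + n)                   ≡⟨ cong (λ k → 4 * (m + k)) (gisGo-stop f 0 H (uniform-stop ρ G (s≤s z≤n) all)) ⟨
    4 * (m + gisGo f 0 H)         ≡⟨ cong (4 *_) unfold ⟨
    4 * gisGo (suc f) b G         ∎

  -- G = Eⁿ leaves no slack in ||D||; for n ≤ 3 the bound ||D′|| ≤ |G′| ≤ n|E| + 1
  -- is better than the one from the window.
  power : ∀ E → 2 ≤ length E → length E ≤ m → length G ≡ n * length E → ∀ k → k ≡ n → gisGo (suc f′) b′ G′ ≤ 4 * m + 4 * n
  power E 2≤E E≤m len 0 eq = ⊥-elim (<⇒≱ (≤-trans (s≤s z≤n) 2≤n) (≤-reflexive (sym eq)))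
  power E 2≤E E≤m len 1 eq = ⊥-elim (<⇒≱ 2≤n (≤-reflexive (sym eq)))
  power E 2≤E E≤m len k@(suc (suc (suc (suc _)))) eq = absorb 0 (4 * n) d≤ (unfold′ _ λ _ → begin
    gisGo f′ 0 H′  ≤⟨ bounded-4+′ n (subst (4 ≤_) eq (s≤s (s≤s (s≤s (s≤s z≤n))))) f′ 0 H′ H′-length ⟩
    4 * n          ≡⟨ +-identityʳ (4 * n) ⟨
    4 * n + 0      ∎)
  -- Here 4n = 8, and the remaining 4 of 11 + 1 is at most twice the length of `E`.
  power E 2≤E E≤m len 2 eq = begin
    gisGo (suc f′) b′ G′            ≤⟨ unfold′ 11 (λ _ → bounded-6 f′ 0 H′ (≤-trans H′-length (≤-reflexive (cong (4 +_) (sym eq))))) ⟩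
    dictSize G′ + 11                ≤⟨ +-monoˡ-≤ 11 (≤-trans (dictSize≤length G′) (near-length near)) ⟩
    1 + length G + 11               ≡⟨ cong (λ k → 1 + k + 11) (trans len (cong (_* length E) (sym eq))) ⟩
    1 + 2 * length E + 11           ≡⟨ e₁ (length E) ⟩
    2 * length E + 4 + 8            ≤⟨ +-monoˡ-≤ 8 (+-monoʳ-≤ (2 * length E) (*-monoʳ-≤ 2 2≤E)) ⟩
    2 * length E + 2 * length E + 8 ≡⟨ e₂ (length E) ⟩
    4 * length E + 8                ≤⟨ +-monoˡ-≤ 8 (*-monoʳ-≤ 4 E≤m) ⟩
    4 * m + 8                       ≡⟨ cong (λ k → 4 * m + 4 * k) eq ⟩
    4 * m + 4 * n                   ∎
    where
    e₁ : ∀ x → 1 + 2 * x + 11 ≡ 2 * x + 4 + 8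
    e₁ = solve-∀
    e₂ : ∀ x → 2 * x + 2 * x + 8 ≡ 4 * x + 8
    e₂ = solve-∀
  -- Here 4n = 12, and the remaining 2 of 13 + 1 is at most the length of `E`.
  power E 2≤E E≤m len 3 eq = begin
    gisGo (suc f′) b′ G′            ≤⟨ unfold′ 13 (λ _ → bounded-7 f′ 0 H′ (≤-trans H′-length (≤-reflexive (cong (4 +_) (sym eq))))) ⟩
    dictSize G′ + 13                ≤⟨ +-monoˡ-≤ 13 (≤-trans (dictSize≤length G′) (near-length near)) ⟩
    1 + length G + 13               ≡⟨ cong (λ k → 1 + k + 13) (trans len (cong (_* length E) (sym eq))) ⟩
    1 + 3 * length E + 13           ≡⟨ e₁ (length E) ⟩
    3 * length E + 2 + 12           ≤⟨ +-monoˡ-≤ 12 (+-monoʳ-≤ (3 * length E) 2≤E) ⟩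
    3 * length E + length E + 12    ≡⟨ e₂ (length E) ⟩
    4 * length E + 12               ≤⟨ +-monoˡ-≤ 12 (*-monoʳ-≤ 4 E≤m) ⟩
    4 * m + 12                      ≡⟨ cong (λ k → 4 * m + 4 * k) eq ⟩
    4 * m + 4 * n                   ∎
    where
    e₁ : ∀ x → 1 + 3 * x + 13 ≡ 3 * x + 2 + 12
    e₁ = solve-∀
    e₂ : ∀ x → 3 * x + x + 12 ≡ 4 * x + 12
    e₂ = solve-∀

  finish : Shape G D → gisGo (suc f′) b′ G′ ≤ 4 * gisGo (suc f) b G
  finish (inj₁ h) = begin
    gisGo (suc f′) b′ G′          ≤⟨ absorb 2 _ h (unfold′ _ (λ fits′ → near-4-growth f f′ 0 0 H H′ fits fits′ (Step.near st))) ⟩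
    4 * m + 4 * gisGo f 0 H       ≡⟨ *-distribˡ-+ 4 m _ ⟨
    4 * (m + gisGo f 0 H)         ≡⟨ cong (4 *_) unfold ⟨
    4 * gisGo (suc f) b G         ∎
  finish (inj₂ (E , _ , all , inj₁ h)) = stopped all
    (absorb 1 (4 * n) h (unfold′ _ λ _ → bounded-4+ n 2≤n f′ 0 H′ H′-length))
  finish (inj₂ (E , 2≤E , all , inj₂ chunk≡E)) = stopped all (power E 2≤E E≤m len n refl)
    where
    parts-all : All (_≡ E) (factors G)
    parts-all = subst (All (_≡ E)) (sym (factors-parts G (s≤s z≤n))) (chunk≡E ∷ all)
    E≤m : length E ≤ m
    E≤m = subst (λ Z → length Z ≤ m) chunk≡E (dictSize-one G (subst (chunk G ∈_) (sym (factors-parts G (s≤s z≤n))) (here refl)))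
    len : length G ≡ n * length E
    len = trans (sym (size-factors G)) (trans (size-const (factors G) parts-all)
            (cong (_* length E) (sym (length-map ρ (factors G)))))

-- The empty string is excluded because its size is 0, while one insertion gives size 1. The
-- difference bound is the ratio bound with one copy of `gis T` subtracted.
theorem27 : (T T' : List ℕ) → T ≢ [] → OneEdit T T'
    → (gis T' ≤ 4 * gis T) × (gis T' ∸ gis T ≤ 3 * gis T)
theorem27 []          T' T≢[] _ = ⊥-elim (T≢[] refl)
theorem27 T@(_ ∷ _) T' _ edit = bound , m≤n+o⇒m∸n≤o _ (gis T) bound
  where
  bound : gis T' ≤ 4 * gis T
  bound = near-1-growth (length T) (length T') _ _ T T' (s≤s z≤n) ≤-refl ≤-refl (edit-near edit)
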